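{- Let $n$ and $k$ be integers with $k \geq 3$ and $n \geq 4k^2 - 4k + 3$, and let $G = \mathrm{Kneser}(n,k)$. Then $$\mathrm{tw}(G) = \binom{n-1}{k} - 1.$$
   Context: For positive integers $n,k$, the Kneser graph $\mathrm{Kneser}(n,k)$ has as vertex set the family of all $k$-element subsets of $[n]=\{1,\dots,n\}$, with two vertices adjacent if and only if they are disjoint sets. A tree decomposition of a graph $G$ is a pair $(T,(B_x)_{x\in V(T)})$ with $T$ a tree and $B_x\subseteq V(G)$, such that for each vertex $v$ the nodes $x$ with $v\in B_x$ induce a non-empty connected subtree of $T$, and each edge of $G$ has both ends in some bag $B_x$. Its width is $\max_x |B_x| - 1$, and the treewidth $\mathrm{tw}(G)$ is the minimum width of a tree decomposition of $G$. -}

module Defs where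

open import Level using (0ℓ)
open import Data.Nat using (ℕ; suc; _≤_; _∸_; _⊔_)
open import Data.Fin using (Fin)
open import Data.Fin.Subset using (Subset; _∩_; ∣_∣; Empty)
open import Data.List using (List; _∷_; []; _++_; length; map; foldr; allFin)
open import Data.List.Membership.Propositional using (_∈_)
open import Data.List.Relation.Unary.Unique.Propositional using (Unique)
open import Data.List.Relation.Unary.Linked using (Linked)
open import Data.Product using (Σ; ∃; _×_; _,_)
open import Relation.Binary.PropositionalEquality using (_≡_)
open import Relation.Nullary using (¬_)
open import Data.Unit using (⊤)

record Graph : Set₁ where
  field
    V : Set
    E : V → V → Set

data WalkIn {m : ℕ} (E : Fin (suc m) → Fin (suc m) → Set)
            (P : Fin (suc m) → Set) : Fin (suc m) → Fin (suc m) → Set where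
  here : ∀ {x} → P x → WalkIn E P x x
  step : ∀ {x y z} → P x → E x y → WalkIn E P y z → WalkIn E P x z

HasCycle : {m : ℕ} → (Fin (suc m) → Fin (suc m) → Set) → Set
HasCycle {m} E = Σ (Fin (suc m)) λ x → Σ (List (Fin (suc m))) λ xs →
  (2 ≤ length xs) × Unique (x ∷ xs) × Linked E (x ∷ xs ++ (x ∷ []))

record Tree : Set₁ where
  field
    m     : ℕ
    TE    : Fin (suc m) → Fin (suc m) → Set
    sym   : ∀ {x y} → TE x y → TE y x
    irrefl : ∀ {x} → ¬ TE x x
    connected : ∀ x y → WalkIn TE (λ _ → ⊤) x y
    acyclic : ¬ HasCycle TE

record TreeDecomposition (G : Graph) : Set₁ where
  open Graph G
  field
    tree : Tree
  open Tree tree public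
  field
    bag        : Fin (suc m) → List V
    bag-unique : ∀ x → Unique (bag x)
    nonempty   : ∀ v → ∃ λ x → v ∈ bag x
    subtree    : ∀ v x y → v ∈ bag x → v ∈ bag y →
                 WalkIn TE (λ z → v ∈ bag z) x y
    edges      : ∀ u v → E u v → ∃ λ x → (u ∈ bag x) × (v ∈ bag x)

width : {G : Graph} → TreeDecomposition G → ℕ
width D = foldr _⊔_ 0 (map (λ x → length (bag x)) (allFin (suc m))) ∸ 1
  where open TreeDecomposition D

Treewidth≡ : Graph → ℕ → Set₁
Treewidth≡ G w =
  (Σ (TreeDecomposition G) λ D → width D ≡ w) ×
  (∀ (D : TreeDecomposition G) → w ≤ width D)

Kneser : ℕ → ℕ → Graph
Kneser n k = record
  { V = Σ (Subset n) (λ s → ∣ s ∣ ≡ k)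
  ; E = λ { (s , _) (t , _) → Empty (s ∩ t) }
  }

{-# OPTIONS --safe #-}
module Submission where

-- Upper bound: in a star-shaped decomposition the centre is the set of k-sets missing the first
-- point, and each k-set v through that point gets a leaf with bag v ∷ N(v).
--
-- Lower bound: put N = C(n-1,k-1). If every bag had fewer than C(n-1,k) vertices, more than N
-- vertices would lie outside each bag. Orienting every node of the tree towards a branch with more
-- than 3/4 of the outside vertices, either some node has no such branch, and its branches can be
-- grouped evenly, or two adjacent nodes point at each other. Both give disjoint, cross-intersecting
-- families A and B with |A| + |B| > N and |A|, |B| > N/4.
--
-- This is impossible. Let |A| ≥ |B|, and write A⁺, A⁻ for the members of A through and missing a
-- point i. Some i ∈ v ∈ A satisfies |B| ≤ k|B⁺|. Points in all of A or all of B are easily excluded, so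
-- |A⁺| ≤ k C(n-2,k-2) ≤ N/4. A Pyber-type inequality, |A||B| ≤ C(n-1,k-1) C(n-1,l-1) for
-- cross-intersecting k- and l-uniform families, improves by a factor 2 unless both families are
-- stars with a common centre; it is proved by induction on n, applied to (A⁻, B⁺) and (A⁺, B⁻).
-- Using it for (A⁻, B⁺) gives 8|A⁻||B| ≤ N², which contradicts the sizes of A and B.

open import Defs
open import Data.Bool using (Bool; true; false; not; _∧_; if_then_else_)
import Data.Bool as Bool
open import Data.Empty using (⊥)
open import Data.Fin using (Fin; zero; suc; toℕ; fromℕ<; punchOut)
open import Data.Fin.Properties
  using (any?; all?; ¬∀⟶∃¬; pigeonhole; punchIn-punchOut; toℕ<n; toℕ-injective; toℕ-fromℕ<)
import Data.Fin.Properties as Fin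
open import Data.Fin.Subset using (Subset; ∣_∣; _∩_; Empty; inside; outside)
open import Data.Fin.Subset.Properties using (x∈p∩q⁻; x∈p∩q⁺; nonempty?; ∩-comm)
open import Data.List using (List; []; _∷_; _++_; length; map; foldr; filter; allFin)
import Data.List as List
import Data.List.Properties as List
open import Data.List.Membership.Propositional using (_∈_; _∉_; lose)
open import Data.List.Membership.Propositional.Properties
  using (∈-map⁺; ∈-map⁻; ∈-allFin; ∈-++⁺ˡ; ∈-++⁺ʳ; ∈-filter⁺; ∈-filter⁻; ∈-lookup)
import Data.List.Membership.DecPropositional as DecMembership
open import Data.List.Relation.Unary.All as All using (All; []; _∷_)
open import Data.List.Relation.Unary.All.Properties using (¬Any⇒All¬)
open import Data.List.Relation.Unary.AllPairs using ([]; _∷_)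
open import Data.List.Relation.Unary.Any using (here; there; index)
open import Data.List.Relation.Unary.Any.Properties using (lookup-index)
open import Data.List.Relation.Unary.Linked using (Linked; [-]; _∷_)
open import Data.List.Relation.Unary.Unique.Propositional using (Unique)
import Data.List.Relation.Unary.Unique.Propositional.Properties as Unique
open import Data.Nat
open import Data.Nat.Combinatorics using (_C_; nC1≡n; nCk+nC[k+1]≡[n+1]C[k+1])
open import Data.Nat.ListAction using (sum)
open import Data.Nat.Properties
open import Data.Nat.Tactic.RingSolver using (solve-∀)
open import Data.Product using (∃; Σ; _×_; _,_; proj₁; proj₂)
open import Data.Sum as Sum using (_⊎_; inj₁; inj₂)
open import Data.Unit using (⊤; tt)
open import Data.Vec using ([]; _∷_; lookup; insertAt)
open import Data.Vec.Properties
  using (≡-dec; lookup⇒[]=; []=⇒lookup; insertAt-lookup; insertAt-punchIn; ∷-injectiveʳ; ∷-injectiveˡ)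
open import Function using (_∘_)
open import Relation.Binary.Definitions using (DecidableEquality)
open import Relation.Binary.PropositionalEquality
open import Relation.Nullary using (¬_; Dec; yes; no; contradiction; does)
open import Relation.Nullary.Decidable using (¬?; _×-dec_; dec-true)

-- Weighted sums over the k-subsets of a finite set

Family : ℕ → Set
Family m = Subset m → Bool

-- The recursion splits on the first point as Pascal's rule does; this is why the constant weight 1
-- sums to a binomial coefficient.
∑ : (m k : ℕ) → (Subset m → ℕ) → ℕ
∑ zero    zero    w = w []
∑ zero    (suc k) w = 0
∑ (suc m) zero    w = ∑ m zero (w ∘ (outside ∷_))
∑ (suc m) (suc k) w = ∑ m k (w ∘ (inside ∷_)) + ∑ m (suc k) (w ∘ (outside ∷_))

𝟙 : Bool → ℕ
𝟙 b = if b then 1 else 0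

𝟙≤1 : ∀ b → 𝟙 b ≤ 1
𝟙≤1 true  = ≤-refl
𝟙≤1 false = z≤n

# : (m k : ℕ) → Family m → ℕ
# m k f = ∑ m k (𝟙 ∘ f)

∑-mono : ∀ m k {w w′ : Subset m → ℕ} → (∀ s → ∣ s ∣ ≡ k → w s ≤ w′ s) → ∑ m k w ≤ ∑ m k w′
∑-mono zero    zero    h = h [] refl
∑-mono zero    (suc k) h = z≤n
∑-mono (suc m) zero    h = ∑-mono m zero (λ s e → h (outside ∷ s) e)
∑-mono (suc m) (suc k) h = +-mono-≤ (∑-mono m k (λ s e → h (inside ∷ s) (cong suc e)))
                                    (∑-mono m (suc k) (λ s e → h (outside ∷ s) e))

interchange : ∀ a b c d → a + b + (c + d) ≡ a + c + (b + d)
interchange = solve-∀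

∑-+ : ∀ m k (w w′ : Subset m → ℕ) → ∑ m k (λ s → w s + w′ s) ≡ ∑ m k w + ∑ m k w′
∑-+ zero    zero    w w′ = refl
∑-+ zero    (suc k) w w′ = refl
∑-+ (suc m) zero    w w′ = ∑-+ m zero _ _
∑-+ (suc m) (suc k) w w′ =
  trans (cong₂ _+_ (∑-+ m k _ _) (∑-+ m (suc k) _ _))
        (interchange (∑ m k _) (∑ m k _) (∑ m (suc k) _) _)

∑-0 : ∀ m k → ∑ m k (λ _ → 0) ≡ 0
∑-0 zero    zero    = refl
∑-0 zero    (suc k) = refl
∑-0 (suc m) zero    = ∑-0 m zero
∑-0 (suc m) (suc k) = cong₂ _+_ (∑-0 m k) (∑-0 m (suc k))

∑-1 : ∀ m k → ∑ m k (λ _ → 1) ≡ m C k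
∑-1 zero    zero    = refl
∑-1 zero    (suc k) = refl
∑-1 (suc m) zero    = ∑-1 m zero
∑-1 (suc m) (suc k) = trans (cong₂ _+_ (∑-1 m k) (∑-1 m (suc k))) (nCk+nC[k+1]≡[n+1]C[k+1] m k)

-- The definition singles out the first point. Any other point can take that role: split at both
-- points and interchange the two middle terms.
∑-split : ∀ m k (i : Fin (suc m)) (w : Subset (suc m) → ℕ) →
  ∑ (suc m) (suc k) w ≡ ∑ m k (λ s → w (insertAt s i inside)) + ∑ m (suc k) (λ s → w (insertAt s i outside))
∑-split₀ : ∀ m (i : Fin (suc m)) (w : Subset (suc m) → ℕ) →
  ∑ (suc m) 0 w ≡ ∑ m 0 (λ s → w (insertAt s i outside))
∑-split₀ m       zero    w = refl
∑-split₀ (suc m) (suc i) w = ∑-split₀ m i (w ∘ (outside ∷_))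
∑-split m       k       zero    w = refl
∑-split (suc m) zero    (suc i) w =
  trans (cong₂ _+_ (∑-split₀ m i (w ∘ (inside ∷_))) (∑-split m zero i (w ∘ (outside ∷_)))) (assoc-swap (∑ m 0 _) (∑ m 0 _) _)
  where
  assoc-swap : ∀ a b c → a + (b + c) ≡ b + (a + c)
  assoc-swap = solve-∀
∑-split (suc m) (suc k) (suc i) w =
  trans (cong₂ _+_ (∑-split m k i (w ∘ (inside ∷_))) (∑-split m (suc k) i (w ∘ (outside ∷_))))
        (interchange (∑ m k _) (∑ m (suc k) _) (∑ m (suc k) _) _)

∑-witness : ∀ m k (w : Subset m → ℕ) → 0 < ∑ m k w → ∃ λ s → ∣ s ∣ ≡ k × 0 < w s
∑-witness zero    zero    w p = [] , refl , p
∑-witness (suc m) zero    w p with ∑-witness m zero _ p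
... | s , e , q = outside ∷ s , e , q
∑-witness (suc m) (suc k) w p with ∑ m k (w ∘ (inside ∷_)) in eq
... | zero with ∑-witness m (suc k) _ p
...   | s , e , q = outside ∷ s , e , q
∑-witness (suc m) (suc k) w p | suc _
  with ∑-witness m k (w ∘ (inside ∷_)) (subst (0 <_) (sym eq) z<s)
...   | s , e , q = inside ∷ s , cong suc e , q

0<𝟙⇒true : ∀ b → 0 < 𝟙 b → b ≡ true
0<𝟙⇒true true _ = refl

#-witness : ∀ m k (f : Family m) → 0 < # m k f → ∃ λ s → ∣ s ∣ ≡ k × f s ≡ true
#-witness m k f p with ∑-witness m k (𝟙 ∘ f) p
... | s , e , q = s , e , 0<𝟙⇒true (f s) q

#-empty : ∀ m k (f : Family m) → (∀ s → ∣ s ∣ ≡ k → ¬ f s ≡ true) → # m k f ≡ 0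
#-empty m k f h with # m k f in eq
... | zero  = refl
... | suc _ with #-witness m k f (subst (0 <_) (sym eq) z<s)
...   | s , e , q = contradiction q (h s e)

#≤C : ∀ m k (f : Family m) → # m k f ≤ m C k
#≤C m k f = ≤-trans (∑-mono m k (λ s _ → 𝟙≤1 (f s))) (≤-reflexive (∑-1 m k))

∣insertAt-outside∣ : ∀ {m} (s : Subset m) i → ∣ insertAt s i outside ∣ ≡ ∣ s ∣
∣insertAt-outside∣ s           zero    = refl
∣insertAt-outside∣ (true ∷ s)  (suc i) = cong suc (∣insertAt-outside∣ s i)
∣insertAt-outside∣ (false ∷ s) (suc i) = ∣insertAt-outside∣ s i

∣insertAt-inside∣ : ∀ {m} (s : Subset m) i → ∣ insertAt s i inside ∣ ≡ suc ∣ s ∣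
∣insertAt-inside∣ s           zero    = refl
∣insertAt-inside∣ (true ∷ s)  (suc i) = cong suc (∣insertAt-inside∣ s i)
∣insertAt-inside∣ (false ∷ s) (suc i) = ∣insertAt-inside∣ s i

-- Links at a point and cross-intersection

_⟨_⟩⁺ _⟨_⟩⁻ : ∀ {m} → Family (suc m) → Fin (suc m) → Family m
(f ⟨ i ⟩⁺) s = f (insertAt s i inside)
(f ⟨ i ⟩⁻) s = f (insertAt s i outside)

Meet : ∀ {m} → Subset m → Subset m → Set
Meet s t = ∃ λ i → lookup s i ≡ true × lookup t i ≡ true

Cross : ∀ {m} → ℕ → ℕ → Family m → Family m → Set
Cross k l f g = ∀ s t → ∣ s ∣ ≡ k → ∣ t ∣ ≡ l → f s ≡ true → g t ≡ true → Meet s t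

Cross-sym : ∀ {m k l} {f g : Family m} → Cross k l f g → Cross l k g f
Cross-sym X s t p q r u with X t s q p u r
... | i , a , b = i , b , a

-- The first set misses i, so the common point differs from i and survives its deletion.
Meet-insertAt : ∀ {m} (s t : Subset m) i b →
  Meet (insertAt s i outside) (insertAt t i b) → Meet s t
Meet-insertAt s t i b (j , p , q) with i Fin.≟ j
... | yes refl with trans (sym (insertAt-lookup s i false)) p
...   | ()
Meet-insertAt s t i b (j , p , q) | no i≢j = punchOut i≢j ,
  trans (sym (insertAt-punchIn s i false _)) (trans (cong (lookup (insertAt s i false)) (punchIn-punchOut i≢j)) p) ,
  trans (sym (insertAt-punchIn t i b _)) (trans (cong (lookup (insertAt t i b)) (punchIn-punchOut i≢j)) q)

-- The engine of the induction on the ground set: the mixed pair of links stays cross-intersecting,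
-- with one point fewer and one uniformity lowered.
Cross-link : ∀ {m k l} {f g : Family (suc m)} i → Cross k (suc l) f g → Cross k l (f ⟨ i ⟩⁻) (g ⟨ i ⟩⁺)
Cross-link i X s t p q r u = Meet-insertAt s t i true
  (X _ _ (trans (∣insertAt-outside∣ s i) p) (trans (∣insertAt-inside∣ t i) (cong suc q)) r u)

-- Popular points

elements : ∀ {m} → Subset m → List (Fin m)
elements []          = []
elements (true ∷ s)  = zero ∷ map suc (elements s)
elements (false ∷ s) = map suc (elements s)

length-elements : ∀ {m} (s : Subset m) → length (elements s) ≡ ∣ s ∣
length-elements []          = refl
length-elements (true ∷ s)  = cong suc (trans (List.length-map suc (elements s)) (length-elements s))
length-elements (false ∷ s) = trans (List.length-map suc (elements s)) (length-elements s)

∈-elements⁺ : ∀ {m} (s : Subset m) i → lookup s i ≡ true → i ∈ elements s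
∈-elements⁺ (true ∷ s)  zero    p = here refl
∈-elements⁺ (true ∷ s)  (suc i) p = there (∈-map⁺ suc (∈-elements⁺ s i p))
∈-elements⁺ (false ∷ s) (suc i) p = ∈-map⁺ suc (∈-elements⁺ s i p)

∑-sum : ∀ {A : Set} m k (h : A → Subset m → ℕ) xs →
  ∑ m k (λ s → sum (map (λ x → h x s) xs)) ≡ sum (map (λ x → ∑ m k (h x)) xs)
∑-sum m k h []       = ∑-0 m k
∑-sum m k h (x ∷ xs) = trans (∑-+ m k _ _) (cong (∑ m k (h x) +_) (∑-sum m k h xs))

∈⇒≤sum : ∀ {A : Set} (h : A → ℕ) {x xs} → x ∈ xs → h x ≤ sum (map h xs)
∈⇒≤sum h (here refl) = m≤m+n _ _
∈⇒≤sum h (there p)   = ≤-trans (∈⇒≤sum h p) (m≤n+m _ _)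

sum≤max : ∀ {A : Set} (h : A → ℕ) x xs → ∃ λ y → y ∈ (x ∷ xs) × sum (map h (x ∷ xs)) ≤ length (x ∷ xs) * h y
sum≤max h x []        = x , here refl , ≤-refl
sum≤max h x (x′ ∷ xs) with sum≤max h x′ xs
... | y , p , q with ≤-total (h x) (h y)
...   | inj₁ hx≤hy = y , there p , +-mono-≤ hx≤hy q
...   | inj₂ hy≤hx = x , here refl , +-monoʳ-≤ (h x) (≤-trans q (*-monoʳ-≤ (length (x′ ∷ xs)) hy≤hx))

through : ∀ {m} → Family m → Fin m → Subset m → ℕ
through g i t = 𝟙 (g t) * 𝟙 (lookup t i)

∑-through : ∀ m l (g : Family (suc m)) i → ∑ (suc m) (suc l) (through g i) ≡ # m l (g ⟨ i ⟩⁺)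
∑-through m l g i = begin
  ∑ (suc m) (suc l) (through g i)
    ≡⟨ ∑-split m l i (through g i) ⟩
  ∑ m l (λ s → through g i (insertAt s i inside)) + ∑ m (suc l) (λ s → through g i (insertAt s i outside))
    ≡⟨ cong₂ _+_ (∑-cong m l on) (trans (∑-cong m (suc l) off) (∑-0 m (suc l))) ⟩
  # m l (g ⟨ i ⟩⁺) + 0
    ≡⟨ +-identityʳ _ ⟩
  # m l (g ⟨ i ⟩⁺) ∎
  where
  open ≡-Reasoning
  ∑-cong : ∀ m k {w w′ : Subset m → ℕ} → (∀ s → w s ≡ w′ s) → ∑ m k w ≡ ∑ m k w′
  ∑-cong m k h = ≤-antisym (∑-mono m k (λ s _ → ≤-reflexive (h s)))
                           (∑-mono m k (λ s _ → ≤-reflexive (sym (h s))))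
  on : ∀ s → through g i (insertAt s i inside) ≡ 𝟙 (g (insertAt s i inside))
  on s rewrite insertAt-lookup s i true = *-identityʳ _
  off : ∀ s → through g i (insertAt s i outside) ≡ 0
  off s rewrite insertAt-lookup s i false = *-zeroʳ (𝟙 (g (insertAt s i false)))

-- Each member of g contains a point of v, so the links of g at the points of v together count at
-- least all of g, and the largest of them reaches the average.
popular-element : ∀ m l (v : Subset (suc m)) (g : Family (suc m)) →
  (∀ t → ∣ t ∣ ≡ suc l → g t ≡ true → Meet v t) → 0 < # (suc m) (suc l) g →
  ∃ λ i → lookup v i ≡ true × # (suc m) (suc l) g ≤ ∣ v ∣ * # m l (g ⟨ i ⟩⁺)
popular-element m l v g h pos = go (elements v) refl
  where
  open ≤-Reasoning
  bound : ∀ t → ∣ t ∣ ≡ suc l → 𝟙 (g t) ≤ sum (map (λ i → through g i t) (elements v))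
  bound t e with g t in eq
  ... | false = z≤n
  ... | true with h t e eq
  ...   | i , p , q = begin
    1 ≡⟨ sym (cong (λ b → 1 * 𝟙 b) q) ⟩
    1 * 𝟙 (lookup t i) ≤⟨ ∈⇒≤sum (λ i → 1 * 𝟙 (lookup t i)) (∈-elements⁺ v i p) ⟩
    sum (map (λ i → 1 * 𝟙 (lookup t i)) (elements v)) ∎
  total : # (suc m) (suc l) g ≤ sum (map (λ i → # m l (g ⟨ i ⟩⁺)) (elements v))
  total = begin
    # (suc m) (suc l) g ≤⟨ ∑-mono (suc m) (suc l) bound ⟩
    ∑ (suc m) (suc l) (λ t → sum (map (λ i → through g i t) (elements v)))
      ≡⟨ ∑-sum (suc m) (suc l) (through g) (elements v) ⟩
    sum (map (λ i → ∑ (suc m) (suc l) (through g i)) (elements v))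
      ≡⟨ cong sum (List.map-cong (∑-through m l g) (elements v)) ⟩
    sum (map (λ i → # m l (g ⟨ i ⟩⁺)) (elements v)) ∎
  ∈-elements⁻ : ∀ {m} (s : Subset m) {i} → i ∈ elements s → lookup s i ≡ true
  ∈-elements⁻ (true ∷ s)  (here refl) = refl
  ∈-elements⁻ (true ∷ s)  (there p) with ∈-map⁻ suc p
  ... | _ , q , refl = ∈-elements⁻ s q
  ∈-elements⁻ (false ∷ s) p with ∈-map⁻ suc p
  ... | _ , q , refl = ∈-elements⁻ s q
  go : ∀ xs → elements v ≡ xs → ∃ λ i → lookup v i ≡ true × # (suc m) (suc l) g ≤ ∣ v ∣ * # m l (g ⟨ i ⟩⁺)
  -- An empty v would bound the positive count of g by an empty sum.
  go [] eq = contradiction (<-≤-trans pos (subst (λ xs → _ ≤ sum (map _ xs)) eq total)) λ ()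
  go (x ∷ xs) eq with sum≤max (λ i → # m l (g ⟨ i ⟩⁺)) x xs
  ... | i , p , q = i , ∈-elements⁻ v (subst (i ∈_) (sym eq) p) , (begin
    # (suc m) (suc l) g ≤⟨ total ⟩
    sum (map (λ i → # m l (g ⟨ i ⟩⁺)) (elements v)) ≡⟨ cong (sum ∘ map _) eq ⟩
    sum (map (λ i → # m l (g ⟨ i ⟩⁺)) (x ∷ xs)) ≤⟨ q ⟩
    length (x ∷ xs) * # m l (g ⟨ i ⟩⁺) ≡⟨ cong (λ xs → length xs * _) (sym eq) ⟩
    length (elements v) * # m l (g ⟨ i ⟩⁺) ≡⟨ cong (_* _) (length-elements v) ⟩
    ∣ v ∣ * # m l (g ⟨ i ⟩⁺) ∎)

-- The number of k-subsets of an m-set through a fixed point.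
star : ℕ → ℕ → ℕ
star (suc m) (suc k) = m C k
star _       _       = 0

#≤∣v∣*star : ∀ m l (v : Subset m) (g : Family m) →
  (∀ t → ∣ t ∣ ≡ l → g t ≡ true → Meet v t) → # m l g ≤ ∣ v ∣ * star m l
#≤∣v∣*star zero l v g h = ≤-trans (≤-reflexive (#-empty 0 l g (λ t e q → no-index {v} {t} (h t e q)))) z≤n
  where
  no-index : ∀ {v t : Subset 0} → ¬ Meet v t
  no-index (() , _)
#≤∣v∣*star (suc m) zero v g h =
  ≤-trans (≤-reflexive (#-empty (suc m) 0 g (λ t e q → empty-misses v t e (h t e q)))) z≤n
  where
  empty-misses : ∀ {m} (v t : Subset m) → ∣ t ∣ ≡ 0 → ¬ Meet v t
  empty-misses (_ ∷ v) (false ∷ t) e (suc i , p , q) = empty-misses v t e (i , p , q)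
#≤∣v∣*star (suc m) (suc l) v g h with # (suc m) (suc l) g in eq
... | zero  = z≤n
... | suc _ with popular-element m l v g h (subst (0 <_) (sym eq) z<s)
...   | i , _ , q = ≤-trans (≤-reflexive (sym eq)) (≤-trans q (*-monoʳ-≤ ∣ v ∣ (#≤C m l (g ⟨ i ⟩⁺))))

-- Cross-intersecting families

-- Induction by Pascal's rule: once a single copy of p is set aside, both remaining terms fall under
-- the induction hypothesis.
C-absorption : ∀ m k → suc k * (suc m C suc k) ≡ suc m * (m C k)
C-absorption zero    zero    = refl
C-absorption zero    (suc k) = *-zeroʳ k
C-absorption (suc m) zero    = trans (*-identityˡ _) (trans (nC1≡n (2 + m)) (sym (*-identityʳ _)))
C-absorption (suc m) (suc k) = begin
  (2 + k) * ((2 + m) C (2 + k))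
    ≡⟨ cong ((2 + k) *_) (sym (nCk+nC[k+1]≡[n+1]C[k+1] (suc m) (suc k))) ⟩
  (2 + k) * (p + q)
    ≡⟨ expand k p q ⟩
  p + (suc k * p + (2 + k) * q)
    ≡⟨ cong (p +_) (cong₂ _+_ (C-absorption m k) (C-absorption m (suc k))) ⟩
  p + (suc m * (m C k) + suc m * (m C suc k))
    ≡⟨ cong (p +_) (sym (*-distribˡ-+ (suc m) (m C k) (m C suc k))) ⟩
  p + suc m * ((m C k) + (m C suc k))
    ≡⟨ cong (λ r → p + suc m * r) (nCk+nC[k+1]≡[n+1]C[k+1] m k) ⟩
  (2 + m) * p ∎
  where
  open ≡-Reasoning
  p = suc m C suc k
  q = suc m C (2 + k)
  expand : ∀ k p q → (2 + k) * (p + q) ≡ p + ((1 + k) * p + (2 + k) * q)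
  expand = solve-∀

C-ratio : ∀ r m k → r * suc k ≤ suc m → r * (m C k) ≤ suc m C suc k
C-ratio r m k h = *-cancelˡ-≤ (suc k) (begin
  suc k * (r * (m C k))   ≡⟨ reorder (suc k) r (m C k) ⟩
  (r * suc k) * (m C k)   ≤⟨ *-monoˡ-≤ (m C k) h ⟩
  suc m * (m C k)         ≡⟨ sym (C-absorption m k) ⟩
  suc k * (suc m C suc k) ∎)
  where
  open ≤-Reasoning
  reorder : ∀ a b c → a * (b * c) ≡ (b * a) * c
  reorder = solve-∀

-- For positive m and l the ratio of `m C l` to `star m l` is m / l, and the hypothesis gives
-- 4(k+1)l ≤ m.
4*star≤C : ∀ k m l → 4 * (suc k * suc l) ≤ 4 + m → 4 * (suc k * star m l) ≤ m C l
4*star≤C k zero    zero    h rewrite *-zeroʳ k = z≤n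
4*star≤C k (suc m) zero    h rewrite *-zeroʳ k = z≤n
4*star≤C k zero    (suc l) h rewrite *-zeroʳ k = z≤n
4*star≤C k (suc m) (suc l) h = ≤-trans (≤-reflexive (sym (*-assoc 4 (suc k) (m C l))))
  (C-ratio (4 * suc k) m l (+-cancelˡ-≤ 4 _ _ (begin
    4 + 4 * suc k * suc l         ≤⟨ m≤m+n _ (4 * k) ⟩
    4 + 4 * suc k * suc l + 4 * k ≡⟨ expand k l ⟩
    4 * (suc k * (2 + l))         ≤⟨ h ⟩
    4 + suc m                     ∎)))
  where
  open ≤-Reasoning
  expand : ∀ k l → 4 + 4 * (1 + k) * (1 + l) + 4 * k ≡ 4 * ((1 + k) * (2 + l))
  expand = solve-∀

star≤C : ∀ m k → star m (suc k) ≤ m C k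
star≤C zero    k       = z≤n
star≤C (suc m) zero    = ≤-refl
star≤C (suc m) (suc k) = ≤-trans (m≤n+m _ _) (≤-reflexive (nCk+nC[k+1]≡[n+1]C[k+1] m k))

-- For one family that is a star at i, of size x, and another split at i into y and y′: both x * y
-- and x * y′ are at most a quarter of K * L.
one-sided : ∀ {x y y′ K L d} → 4 * x ≤ K → y ≤ L → 4 * d ≤ K → x * y′ ≤ d * L →
  2 * (x * (y + y′)) ≤ K * L
one-sided {x} {y} {y′} {K} {L} {d} 4x≤K y≤L 4d≤K xy′≤dL = *-cancelˡ-≤ 2 (begin
  2 * (2 * (x * (y + y′)))     ≡⟨ expand x y y′ ⟩
  4 * x * y + 4 * (x * y′)     ≤⟨ +-mono-≤ (*-mono-≤ 4x≤K y≤L) (*-monoʳ-≤ 4 xy′≤dL) ⟩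
  K * L + 4 * (d * L)          ≡⟨ cong (K * L +_) (sym (*-assoc 4 d L)) ⟩
  K * L + 4 * d * L            ≤⟨ +-monoʳ-≤ (K * L) (*-monoˡ-≤ L 4d≤K) ⟩
  K * L + K * L                ≡⟨ cong (K * L +_) (sym (+-identityʳ (K * L))) ⟩
  2 * (K * L)                  ∎)
  where
  open ≤-Reasoning
  expand : ∀ x y z → 2 * (2 * (x * (y + z))) ≡ 4 * x * y + 4 * (x * z)
  expand = solve-∀

-- For two families that both have members missing i. If x * y is small, the popularity of i bounds
-- the second family by k * y. If x * y is large, the bounds on the mixed products force x′ * y′ to
-- be small, and then all four products are small.
two-sided : ∀ {x x′ y y′ K L d e k l} →
  x′ * y ≤ K * e → x * y′ ≤ d * L → y + y′ ≤ k * y →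
  4 * (k * e) ≤ L → 4 * (l * d) ≤ K → x ≤ l * d → y ≤ k * e →
  (8 * d ≤ K × 8 * e ≤ L) ⊎ x * y ≡ 0 →
  2 * ((x + x′) * (y + y′)) ≤ K * L
two-sided {x} {x′} {y} {y′} {K} {L} {d} {e} {k} {l} x′y xy′ b≤ky 4ke≤L 4ld≤K x≤ld y≤ke degenerate
  with 4 * (k * (x * y)) ≤? K * L
... | yes 4kxy≤KL = *-cancelˡ-≤ 2 (begin
  2 * (2 * ((x + x′) * (y + y′)))           ≤⟨ *-monoʳ-≤ 2 (*-monoʳ-≤ 2 (*-monoʳ-≤ (x + x′) b≤ky)) ⟩
  2 * (2 * ((x + x′) * (k * y)))            ≡⟨ expand x x′ y k ⟩
  4 * (k * (x * y)) + 4 * k * (x′ * y)      ≤⟨ +-mono-≤ 4kxy≤KL (*-monoʳ-≤ (4 * k) x′y) ⟩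
  K * L + 4 * k * (K * e)                   ≡⟨ cong (K * L +_) (reorder k K e) ⟩
  K * L + K * (4 * (k * e))                 ≤⟨ +-monoʳ-≤ (K * L) (*-monoʳ-≤ K 4ke≤L) ⟩
  K * L + K * L                             ≡⟨ cong (K * L +_) (sym (+-identityʳ (K * L))) ⟩
  2 * (K * L)                               ∎)
  where
  open ≤-Reasoning
  expand : ∀ x x′ y k → 2 * (2 * ((x + x′) * (k * y))) ≡ 4 * (k * (x * y)) + 4 * k * (x′ * y)
  expand = solve-∀
  reorder : ∀ k K e → 4 * k * (K * e) ≡ K * (4 * (k * e))
  reorder = solve-∀
... | no 4kxy≰KL = main degenerate
  where
  open ≤-Reasoning
  KL<4kxy : K * L < 4 * (k * (x * y))
  KL<4kxy = ≰⇒> 4kxy≰KL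
  main : (8 * d ≤ K × 8 * e ≤ L) ⊎ x * y ≡ 0 → 2 * ((x + x′) * (y + y′)) ≤ K * L
  -- In the degenerate case x * y is 0, hence not large.
  main (inj₂ xy≡0) = contradiction (begin-strict
    K * L             <⟨ KL<4kxy ⟩
    4 * (k * (x * y)) ≡⟨ cong (λ z → 4 * (k * z)) xy≡0 ⟩
    4 * (k * 0)       ≡⟨ cong (4 *_) (*-zeroʳ k) ⟩
    0                 ∎) λ ()
  -- As fractions of K * L, the product x * y is at most 1/16 and the other three at most 1/8 each;
  -- twice their sum is 7/8.
  main (inj₁ (8d≤K , 8e≤L)) = *-cancelˡ-≤ 8 (begin
    8 * (2 * ((x + x′) * (y + y′)))
      ≡⟨ expand x x′ y y′ ⟩
    4 * x * (4 * y) + 16 * (x * y′) + 16 * (x′ * y) + 16 * (x′ * y′)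
      ≤⟨ +-mono-≤ (+-mono-≤ (+-mono-≤ (*-mono-≤ 4x≤K 4y≤L) (*-monoʳ-≤ 16 xy′)) (*-monoʳ-≤ 16 x′y))
                  (*-monoʳ-≤ 16 x′y′≤dL) ⟩
    K * L + 16 * (d * L) + 16 * (K * e) + 16 * (d * L)
      ≡⟨ collect K L d e ⟩
    K * L + 4 * (8 * d * L) + 2 * (K * (8 * e))
      ≤⟨ +-mono-≤ (+-monoʳ-≤ (K * L) (*-monoʳ-≤ 4 (*-monoˡ-≤ L 8d≤K))) (*-monoʳ-≤ 2 (*-monoʳ-≤ K 8e≤L)) ⟩
    K * L + 4 * (K * L) + 2 * (K * L)
      ≤⟨ m≤m+n _ (K * L) ⟩
    K * L + 4 * (K * L) + 2 * (K * L) + K * L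
      ≡⟨ eight (K * L) ⟩
    8 * (K * L) ∎)
    where
    expand : ∀ x x′ y y′ → 8 * (2 * ((x + x′) * (y + y′)))
      ≡ 4 * x * (4 * y) + 16 * (x * y′) + 16 * (x′ * y) + 16 * (x′ * y′)
    expand = solve-∀
    collect : ∀ K L d e → K * L + 16 * (d * L) + 16 * (K * e) + 16 * (d * L)
      ≡ K * L + 4 * (8 * d * L) + 2 * (K * (8 * e))
    collect = solve-∀
    eight : ∀ n → n + 4 * n + 2 * n + n ≡ 8 * n
    eight = solve-∀
    4x≤K : 4 * x ≤ K
    4x≤K = ≤-trans (*-monoʳ-≤ 4 x≤ld) 4ld≤K
    4y≤L : 4 * y ≤ L
    4y≤L = ≤-trans (*-monoʳ-≤ 4 y≤ke) 4ke≤L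
    xy≢0 : NonZero (x * y)
    xy≢0 with x * y | KL<4kxy
    ... | suc _ | _ = _
    ... | zero  | p = contradiction (<-≤-trans p (≤-reflexive (cong (4 *_) (*-zeroʳ k)))) λ ()
    -- Multiplying by x * y regroups the left side into the two mixed products; the lower bound on x
    -- * y then pays for the factor K * L.
    x′y′≤dL : x′ * y′ ≤ d * L
    x′y′≤dL = *-cancelʳ-≤ _ _ (x * y) ⦃ xy≢0 ⦄ (begin
      x′ * y′ * (x * y)           ≡⟨ swap x′ y′ x y ⟩
      (x′ * y) * (x * y′)         ≤⟨ *-mono-≤ x′y xy′ ⟩
      K * e * (d * L)             ≡⟨ swap K e d L ⟩
      (K * L) * (d * e)           ≤⟨ *-monoˡ-≤ (d * e) (<⇒≤ KL<4kxy) ⟩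
      4 * (k * (x * y)) * (d * e) ≡⟨ regroup k (x * y) d e ⟩
      d * (4 * (k * e)) * (x * y) ≤⟨ *-monoˡ-≤ (x * y) (*-monoʳ-≤ d 4ke≤L) ⟩
      d * L * (x * y)             ∎)
      where
      swap : ∀ a b c d → a * b * (c * d) ≡ a * d * (c * b)
      swap = solve-∀
      regroup : ∀ k z d e → 4 * (k * z) * (d * e) ≡ d * (4 * (k * e)) * z
      regroup = solve-∀

-- A single member of f missing i must be met by every member of g through i, at one of its own k
-- points.
link-bound : ∀ {m k l} {f g : Family (suc m)} → Cross k (suc l) f g → ∀ i →
  0 < # m k (f ⟨ i ⟩⁻) → # m l (g ⟨ i ⟩⁺) ≤ k * star m l
link-bound {m} {k} {l} {f} {g} X i p with #-witness m k (f ⟨ i ⟩⁻) p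
... | v , refl , q = #≤∣v∣*star m l v (g ⟨ i ⟩⁺) (λ t e r → Cross-link {f = f} {g} i X v t refl e q r)

*-star-0 : ∀ m r → r * star m 0 ≤ 0
*-star-0 zero    r = ≤-reflexive (*-zeroʳ r)
*-star-0 (suc m) r = ≤-reflexive (*-zeroʳ r)

m≡0⊎0<m : ∀ m → m ≡ 0 ⊎ 0 < m
m≡0⊎0<m zero    = inj₁ refl
m≡0⊎0<m (suc m) = inj₂ z<s

#-split : ∀ m k (f : Family (suc m)) i → # (suc m) (suc k) f ≡ # m k (f ⟨ i ⟩⁺) + # m (suc k) (f ⟨ i ⟩⁻)
#-split m k f i = ∑-split m k i (𝟙 ∘ f)

#-through : ∀ m k (f : Family (suc m)) i → # m (suc k) (f ⟨ i ⟩⁻) ≡ 0 → # (suc m) (suc k) f ≡ # m k (f ⟨ i ⟩⁺)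
#-through m k f i p = trans (#-split m k f i) (trans (cong (# m k (f ⟨ i ⟩⁺) +_) p) (+-identityʳ _))

-- The Pyber-type inequality, mutually recursive with `cross-dichotomy`: that lemma settles positive
-- uniformities with both families nonempty, and calls this one on a ground set with one point
-- fewer.
cross-product : ∀ m k l (f g : Family m) → 4 * (k * l) ≤ 3 + m → Cross k l f g →
  # m k f * # m l g ≤ star m k * star m l

-- Split both families at a point i popular for g. The inductive bounds on the mixed pairs of links
-- feed `one-sided` or `two-sided`, unless no member of either family misses i.
cross-dichotomy : ∀ m k l (f g : Family (suc m)) → 4 * (suc k * suc l) ≤ 4 + m →
  Cross (suc k) (suc l) f g → 0 < # (suc m) (suc k) f → 0 < # (suc m) (suc l) g →
  2 * (# (suc m) (suc k) f * # (suc m) (suc l) g) ≤ (m C k) * (m C l) ⊎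
  ∃ λ i → # m (suc k) (f ⟨ i ⟩⁻) ≡ 0 × # m (suc l) (g ⟨ i ⟩⁻) ≡ 0

cross-product m k l f g h X with # m k f in eq
... | zero = z≤n
... | suc a with #-witness m k f (subst (0 <_) (sym eq) z<s)
...   | v , refl , fv = go m k l f g h X eq (#≤∣v∣*star m l v g (λ t e r → X v t refl e fv r))
  where
  null : ∀ a b c {d} → b ≤ c → c ≡ 0 → a * b ≤ d
  null a b c b≤c c≡0 rewrite n≤0⇒n≡0 (≤-trans b≤c (≤-reflexive c≡0)) | *-zeroʳ a = z≤n
  -- The match on `refl` has identified k with the size of v, so the case split on k takes place
  -- with fresh parameters.
  go : ∀ m k l (f g : Family m) → 4 * (k * l) ≤ 3 + m → Cross k l f g → # m k f ≡ suc a →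
       # m l g ≤ k * star m l → suc a * # m l g ≤ star m k * star m l
  go zero    k       l       f g h X eq b = null (suc a) _ _ b (*-zeroʳ k)
  go (suc m) zero    l       f g h X eq b = null (suc a) _ _ b refl
  go (suc m) (suc k) zero    f g h X eq b = null (suc a) _ _ b (*-zeroʳ k)
  go (suc m) (suc k) (suc l) f g h X eq b with m≡0⊎0<m (# (suc m) (suc l) g)
  ... | inj₁ b≡0 = null (suc a) _ _ (≤-refl) b≡0
  ... | inj₂ 0<b with cross-dichotomy m k l f g h X (subst (0 <_) (sym eq) z<s) 0<b
  ...   | inj₁ p = ≤-trans (m≤m+n (suc a * # (suc m) (suc l) g) _)
    (subst (λ a → 2 * (a * # (suc m) (suc l) g) ≤ (m C k) * (m C l)) eq p)
  ...   | inj₂ (i , p , q) = *-mono-≤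
    (subst (_≤ m C k) eq (≤-trans (≤-reflexive (#-through m k f i p)) (#≤C m k _)))
    (≤-trans (≤-reflexive (#-through m l g i q)) (#≤C m l _))

cross-dichotomy m k l f g h X 0<a 0<b
  with #-witness (suc m) (suc k) f 0<a
... | v , ∣v∣≡k , fv with popular-element m l v g (λ t e r → X v t ∣v∣≡k e fv r) 0<b
...   | i , _ , b≤ky = go (m≡0⊎0<m x′) (m≡0⊎0<m y′)
  where
  open ≤-Reasoning
  x x′ y y′ K L d e : ℕ
  x  = # m k (f ⟨ i ⟩⁺)
  x′ = # m (suc k) (f ⟨ i ⟩⁻)
  y  = # m l (g ⟨ i ⟩⁺)
  y′ = # m (suc l) (g ⟨ i ⟩⁻)
  K = m C k
  L = m C l
  d = star m k
  e = star m l
  a≡ : # (suc m) (suc k) f ≡ x + x′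
  a≡ = #-split m k f i
  b≡ : # (suc m) (suc l) g ≡ y + y′
  b≡ = #-split m l g i
  X′ : Cross (suc l) (suc k) g f
  X′ = Cross-sym {f = f} {g} X
  swapped : 4 * (suc l * suc k) ≤ 4 + m
  swapped = subst (λ z → 4 * z ≤ 4 + m) (*-comm (suc k) (suc l)) h
  -- A link loses one point on the right, while the lowered uniformity saves 4 * suc a on the left.
  weaken : ∀ {a b} → 4 * (suc a * suc b) ≤ 4 + m → 4 * (suc a * b) ≤ 3 + m
  weaken {a} {b} p = +-cancelˡ-≤ 1 _ _ (begin
    1 + 4 * (suc a * b)       ≤⟨ m≤m+n _ (3 + 4 * a) ⟩
    1 + 4 * (suc a * b) + (3 + 4 * a) ≡⟨ expand a b ⟩
    4 * (suc a * suc b)       ≤⟨ p ⟩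
    4 + m                     ∎)
    where
    expand : ∀ a b → 1 + 4 * ((1 + a) * b) + (3 + 4 * a) ≡ 4 * ((1 + a) * (1 + b))
    expand = solve-∀
  4ke≤L : 4 * (suc k * e) ≤ L
  4ke≤L = 4*star≤C k m l h
  4ld≤K : 4 * (suc l * d) ≤ K
  4ld≤K = 4*star≤C l m k swapped
  x′y : x′ * y ≤ K * e
  x′y = ≤-trans (cross-product m (suc k) l (f ⟨ i ⟩⁻) (g ⟨ i ⟩⁺) (weaken {k} {l} h) (Cross-link {f = f} {g} i X))
                (*-monoˡ-≤ e (star≤C m k))
  xy′ : x * y′ ≤ d * L
  xy′ = begin
    x * y′                   ≡⟨ *-comm x y′ ⟩
    y′ * x                   ≤⟨ cross-product m (suc l) k (g ⟨ i ⟩⁻) (f ⟨ i ⟩⁺) (weaken {l} {k} swapped)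
                                  (Cross-link {f = g} {f} i X′) ⟩
    star m (suc l) * d       ≤⟨ *-monoˡ-≤ d (star≤C m l) ⟩
    L * d                    ≡⟨ *-comm L d ⟩
    d * L                    ∎
  y≤ke : 0 < x′ → y ≤ suc k * e
  y≤ke = link-bound {f = f} {g} X i
  x≤ld : 0 < y′ → x ≤ suc l * d
  x≤ld = link-bound {f = g} {f} X′ i
  -- The factor 8 needs uniformity suc k at least 2; families of singletons are set apart.
  eight : ∀ k l → 4 * (suc k * star m l) ≤ m C l → 8 * star m l ≤ m C l ⊎ k ≡ 0
  eight zero    l r = inj₂ refl
  eight (suc k) l r = inj₁ (begin
    8 * star m l                               ≤⟨ m≤m+n _ (4 * k * star m l) ⟩
    8 * star m l + 4 * k * star m l            ≡⟨ expand k (star m l) ⟩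
    4 * ((2 + k) * star m l)                   ≤⟨ r ⟩
    m C l                                      ∎)
    where
    expand : ∀ k s → 8 * s + 4 * k * s ≡ 4 * ((2 + k) * s)
    expand = solve-∀
  degenerate : 0 < x′ → 0 < y′ → (8 * d ≤ K × 8 * e ≤ L) ⊎ x * y ≡ 0
  degenerate p q with eight k l 4ke≤L | eight l k 4ld≤K
  ... | inj₁ 8e≤L | inj₁ 8d≤K = inj₁ (8d≤K , 8e≤L)
  -- If f consists of singletons, its only possible member through i is {i}, which cannot meet a
  -- member of g missing i; so x is 0. The next case is symmetric.
  ... | inj₂ refl | _         = inj₂ (cong (_* y) (n≤0⇒n≡0 (≤-trans (x≤ld q) (*-star-0 m (suc l)))))
  ... | _         | inj₂ refl = inj₂ (trans (cong (x *_) (n≤0⇒n≡0 (≤-trans (y≤ke p) (*-star-0 m (suc k))))) (*-zeroʳ x))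
  go : x′ ≡ 0 ⊎ 0 < x′ → y′ ≡ 0 ⊎ 0 < y′ → _
  go (inj₁ x′≡0) (inj₁ y′≡0) = inj₂ (i , x′≡0 , y′≡0)
  go (inj₁ x′≡0) (inj₂ 0<y′) = inj₁ (begin
    2 * (# (suc m) (suc k) f * # (suc m) (suc l) g)
      ≡⟨ cong₂ (λ a b → 2 * (a * b)) (#-through m k f i x′≡0) b≡ ⟩
    2 * (x * (y + y′))
      ≤⟨ one-sided {x} {y} {y′} {K} {L} {d} (≤-trans (*-monoʳ-≤ 4 (x≤ld 0<y′)) 4ld≤K) (#≤C m l _)
           (≤-trans (*-monoʳ-≤ 4 (m≤n*m d (suc l))) 4ld≤K) xy′ ⟩
    K * L ∎)
  go (inj₂ 0<x′) (inj₁ y′≡0) = inj₁ (begin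
    2 * (# (suc m) (suc k) f * # (suc m) (suc l) g)
      ≡⟨ cong₂ (λ a b → 2 * (a * b)) a≡ (#-through m l g i y′≡0) ⟩
    2 * ((x + x′) * y)
      ≡⟨ cong (2 *_) (*-comm (x + x′) y) ⟩
    2 * (y * (x + x′))
      ≤⟨ one-sided {y} {x} {x′} {L} {K} {e} (≤-trans (*-monoʳ-≤ 4 (y≤ke 0<x′)) 4ke≤L) (#≤C m k _)
           (≤-trans (*-monoʳ-≤ 4 (m≤n*m e (suc k))) 4ke≤L)
           (≤-trans (≤-reflexive (*-comm y x′)) (≤-trans x′y (≤-reflexive (*-comm K e)))) ⟩
    L * K ≡⟨ *-comm L K ⟩
    K * L ∎)
  go (inj₂ 0<x′) (inj₂ 0<y′) = inj₁ (begin
    2 * (# (suc m) (suc k) f * # (suc m) (suc l) g)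
      ≡⟨ cong₂ (λ a b → 2 * (a * b)) a≡ b≡ ⟩
    2 * ((x + x′) * (y + y′))
      ≤⟨ two-sided {x} {x′} {y} {y′} {K} {L} {d} {e} {suc k} {suc l} x′y xy′
           (subst₂ (λ a b → a ≤ b * y) b≡ ∣v∣≡k b≤ky) 4ke≤L 4ld≤K (x≤ld 0<y′) (y≤ke 0<x′)
           (degenerate 0<x′ 0<y′) ⟩
    K * L ∎)

-- Disjoint cross-intersecting pairs

Disjoint : ∀ {m} → ℕ → Family m → Family m → Set
Disjoint k f g = ∀ s → ∣ s ∣ ≡ k → f s ≡ true → ¬ g s ≡ true

disjoint-# : ∀ m k (f g : Family m) → Disjoint k f g → # m k f + # m k g ≤ m C k
disjoint-# m k f g D = ≤-trans (≤-reflexive (sym (∑-+ m k (𝟙 ∘ f) (𝟙 ∘ g))))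
  (≤-trans (∑-mono m k λ s e → pointwise (f s) (g s) (D s e)) (≤-reflexive (∑-1 m k)))
  where
  pointwise : ∀ b c → (b ≡ true → ¬ c ≡ true) → 𝟙 b + 𝟙 c ≤ 1
  pointwise true  true  h = contradiction refl (h refl)
  pointwise true  false h = ≤-refl
  pointwise false c     h = 𝟙≤1 c

<4*⇒0< : ∀ {n b} → n < 4 * b → 0 < b
<4*⇒0< {b = suc b} _ = z<s

-- At a = N - b the left side exceeds the right side by (4b - N)(2b - N), so the thresholds
-- N/4 and N/2 on b are exactly the two roots.
balanced-product : ∀ {N a b} → N < a + b → N < 4 * b → b ≤ a → N * N + 2 * (N * b) < 8 * (a * b)
balanced-product {N} {a} {b} N<a+b N<4b b≤a with N <? 2 * b
... | yes N<2b = begin-strict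
  N * N + 2 * (N * b)                <⟨ +-monoˡ-< _ (*-mono-< N<2b N<2b) ⟩
  2 * b * (2 * b) + 2 * (N * b)      ≤⟨ +-monoʳ-≤ (2 * b * (2 * b)) (*-monoʳ-≤ 2 (*-monoˡ-≤ b (<⇒≤ N<2b))) ⟩
  2 * b * (2 * b) + 2 * (2 * b * b)  ≡⟨ collect b ⟩
  8 * (b * b)                        ≤⟨ *-monoʳ-≤ 8 (*-monoˡ-≤ b b≤a) ⟩
  8 * (a * b)                        ∎
  where
  open ≤-Reasoning
  collect : ∀ b → 2 * b * (2 * b) + 2 * (2 * b * b) ≡ 8 * (b * b)
  collect = solve-∀
... | no N≮2b with m≤n⇒∃[o]m+o≡n (≮⇒≥ N≮2b)
...   | c , refl = begin-strict
  (2 * b + c) * (2 * b + c) + 2 * ((2 * b + c) * b) ≡⟨ expand b c ⟩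
  8 * (b * b) + 6 * (b * c) + c * c        ≤⟨ +-monoʳ-≤ (8 * (b * b) + 6 * (b * c)) (*-monoʳ-≤ c c≤2b) ⟩
  8 * (b * b) + 6 * (b * c) + c * (2 * b)  <⟨ m<m+n _ 0<8b ⟩
  8 * (b * b) + 6 * (b * c) + c * (2 * b) + 8 * b ≡⟨ collect b c ⟩
  8 * ((1 + b + c) * b)                    ≤⟨ *-monoʳ-≤ 8 (*-monoˡ-≤ b 1+b+c≤a) ⟩
  8 * (a * b)                              ∎
  where
  open ≤-Reasoning
  expand : ∀ b c → (2 * b + c) * (2 * b + c) + 2 * ((2 * b + c) * b) ≡ 8 * (b * b) + 6 * (b * c) + c * c
  expand = solve-∀
  collect : ∀ b c → 8 * (b * b) + 6 * (b * c) + c * (2 * b) + 8 * b ≡ 8 * ((1 + b + c) * b)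
  collect = solve-∀
  double : ∀ b → 4 * b ≡ 2 * b + 2 * b
  double = solve-∀
  c≤2b : c ≤ 2 * b
  c≤2b = <⇒≤ (+-cancelˡ-< (2 * b) c (2 * b) (<-≤-trans N<4b (≤-reflexive (double b))))
  0<8b : 0 < 8 * b
  0<8b = *-mono-< {0} {8} z<s (<4*⇒0< {b = b} N<4b)
  shift : ∀ b c → suc (2 * b + c) ≡ (1 + b + c) + b
  shift = solve-∀
  1+b+c≤a : 1 + b + c ≤ a
  1+b+c≤a = +-cancelʳ-≤ b (1 + b + c) a (≤-trans (≤-reflexive (sym (shift b c))) N<a+b)

-- Here n = 2 + m and k = 2 + j. Split at a point i popular for the smaller family g. If both
-- families lie through i, disjointness gives a + b ≤ N; if exactly one does, it has at most k * e ≤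
-- N/4 members. Otherwise 8ab is at most N² + 2Nb, against `balanced-product`.
no-balanced-cross : ∀ m j (f g : Family (2 + m)) → 4 * ((2 + j) * (1 + j)) ≤ 1 + m →
  Cross (2 + j) (2 + j) f g → Disjoint (2 + j) f g →
  suc m C suc j < # (2 + m) (2 + j) f + # (2 + m) (2 + j) g →
  suc m C suc j < 4 * # (2 + m) (2 + j) g →
  # (2 + m) (2 + j) g ≤ # (2 + m) (2 + j) f → ⊥
no-balanced-cross m j f g h X D N<a+b N<4b b≤a
  with #-witness (2 + m) (2 + j) f (<-≤-trans (<4*⇒0< N<4b) b≤a)
... | v , ∣v∣≡k , fv
  with popular-element (suc m) (suc j) v g (λ t e r → X v t ∣v∣≡k e fv r) (<4*⇒0< N<4b)
...   | i , _ , b≤∣v∣y = go (m≡0⊎0<m x′) (m≡0⊎0<m y′)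
  where
  open ≤-Reasoning
  a b x x′ y y′ N K e : ℕ
  a  = # (2 + m) (2 + j) f
  b  = # (2 + m) (2 + j) g
  x  = # (suc m) (suc j) (f ⟨ i ⟩⁺)
  x′ = # (suc m) (2 + j) (f ⟨ i ⟩⁻)
  y  = # (suc m) (suc j) (g ⟨ i ⟩⁺)
  y′ = # (suc m) (2 + j) (g ⟨ i ⟩⁻)
  N  = suc m C suc j
  K  = m C suc j
  e  = m C j
  -- The ratio N / e is (n-1)/(k-1), so this is the size hypothesis 4k(k-1) ≤ n-1.
  4ke≤N : 4 * ((2 + j) * e) ≤ N
  4ke≤N = ≤-trans (≤-reflexive (sym (*-assoc 4 (2 + j) e)))
    (C-ratio (4 * (2 + j)) m j (≤-trans (≤-reflexive (*-assoc 4 (2 + j) (1 + j))) h))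
  b≤ky : b ≤ (2 + j) * y
  b≤ky = subst (λ k → b ≤ k * y) ∣v∣≡k b≤∣v∣y
  0<y : 0 < y
  0<y with y | b≤ky
  ... | suc _ | _ = z<s
  ... | zero  | p = contradiction (<-≤-trans N<4b (*-monoʳ-≤ 4 (≤-trans p (≤-reflexive (*-zeroʳ (2 + j)))))) λ ()
  y≤ke : 0 < x′ → y ≤ (2 + j) * e
  y≤ke = link-bound {f = f} {g} X i
  x≤ke : 0 < y′ → x ≤ (2 + j) * e
  x≤ke = link-bound {f = g} {f} (Cross-sym {f = f} {g} X) i
  b≰ke : ¬ b ≤ (2 + j) * e
  b≰ke p = <⇒≱ N<4b (≤-trans (*-monoʳ-≤ 4 p) 4ke≤N)
  a≰ke : ¬ a ≤ (2 + j) * e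
  a≰ke p = b≰ke (≤-trans b≤a p)
  go : x′ ≡ 0 ⊎ 0 < x′ → y′ ≡ 0 ⊎ 0 < y′ → ⊥
  go (inj₁ x′≡0) (inj₁ y′≡0) = <⇒≱ N<a+b (begin
    a + b ≡⟨ cong₂ _+_ (#-through (suc m) (suc j) f i x′≡0) (#-through (suc m) (suc j) g i y′≡0) ⟩
    x + y ≤⟨ disjoint-# (suc m) (suc j) _ _ (λ s e → D (insertAt s i true) (trans (∣insertAt-inside∣ s i) (cong suc e))) ⟩
    N     ∎)
  go (inj₁ x′≡0) (inj₂ 0<y′) = a≰ke (≤-trans (≤-reflexive (#-through (suc m) (suc j) f i x′≡0)) (x≤ke 0<y′))
  go (inj₂ 0<x′) (inj₁ y′≡0) = b≰ke (≤-trans (≤-reflexive (#-through (suc m) (suc j) g i y′≡0)) (y≤ke 0<x′))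
  go (inj₂ 0<x′) (inj₂ 0<y′)
    with cross-dichotomy m (suc j) j (f ⟨ i ⟩⁻) (g ⟨ i ⟩⁺) (≤-trans h (+-monoˡ-≤ m (s≤s z≤n)))
           (Cross-link {f = f} {g} i X) 0<x′ 0<y
  -- A common centre i′ puts all members of g through i also through i′, so y ≤ e and b ≤ k * e.
  ... | inj₂ (i′ , _ , p) = b≰ke (≤-trans b≤ky (*-monoʳ-≤ (2 + j)
          (≤-trans (≤-reflexive (#-through m j (g ⟨ i ⟩⁺) i′ p)) (#≤C m j _))))
  ... | inj₁ 2x′y≤KL = <⇒≱ (balanced-product N<a+b N<4b b≤a) (begin
    8 * (a * b)                         ≡⟨ cong (λ a → 8 * (a * b)) (#-split (suc m) (suc j) f i) ⟩
    8 * ((x + x′) * b)                  ≡⟨ expand x x′ b ⟩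
    8 * (x′ * b) + 2 * (4 * x * b)      ≤⟨ +-mono-≤ (*-monoʳ-≤ 8 (*-monoʳ-≤ x′ b≤ky)) (*-monoʳ-≤ 2 (*-monoˡ-≤ b 4x≤N)) ⟩
    8 * (x′ * ((2 + j) * y)) + 2 * (N * b) ≡⟨ cong (_+ 2 * (N * b)) (regroup x′ (2 + j) y) ⟩
    4 * (2 + j) * (2 * (x′ * y)) + 2 * (N * b) ≤⟨ +-monoˡ-≤ _ (*-monoʳ-≤ (4 * (2 + j)) 2x′y≤KL) ⟩
    4 * (2 + j) * (K * e) + 2 * (N * b) ≡⟨ cong (_+ 2 * (N * b)) (reorder (2 + j) K e) ⟩
    K * (4 * ((2 + j) * e)) + 2 * (N * b) ≤⟨ +-monoˡ-≤ _ (*-mono-≤ K≤N 4ke≤N) ⟩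
    N * N + 2 * (N * b)                 ∎)
    where
    4x≤N : 4 * x ≤ N
    4x≤N = ≤-trans (*-monoʳ-≤ 4 (x≤ke 0<y′)) 4ke≤N
    K≤N : K ≤ N
    K≤N = ≤-trans (m≤n+m _ _) (≤-reflexive (nCk+nC[k+1]≡[n+1]C[k+1] m j))
    expand : ∀ x x′ b → 8 * ((x + x′) * b) ≡ 8 * (x′ * b) + 2 * (4 * x * b)
    expand = solve-∀
    regroup : ∀ x k y → 8 * (x * (k * y)) ≡ 4 * k * (2 * (x * y))
    regroup = solve-∀
    reorder : ∀ k K e → 4 * k * (K * e) ≡ K * (4 * (k * e))
    reorder = solve-∀

-- Walks and branches in trees

module _ {m : ℕ} {E : Fin (suc m) → Fin (suc m) → Set} where

  private
    Node = Fin (suc m)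

  walk-map : ∀ {P Q : Node → Set} → (∀ {z} → P z → Q z) → ∀ {x y} → WalkIn E P x y → WalkIn E Q x y
  walk-map h (WalkIn.here p)     = WalkIn.here (h p)
  walk-map h (WalkIn.step p e w) = WalkIn.step (h p) e (walk-map h w)

  walk-end : ∀ {P x y} → WalkIn E P x y → P y
  walk-end (WalkIn.here p)     = p
  walk-end (WalkIn.step _ _ w) = walk-end w

  infixr 5 _++ʷ_
  _++ʷ_ : ∀ {P x y z} → WalkIn E P x y → WalkIn E P y z → WalkIn E P x z
  WalkIn.here _     ++ʷ w′ = w′
  WalkIn.step p e w ++ʷ w′ = WalkIn.step p e (w ++ʷ w′)

  walk-reverse : (∀ {x y} → E x y → E y x) → ∀ {P x y} → WalkIn E P x y → WalkIn E P y x
  walk-reverse E-sym (WalkIn.here p)     = WalkIn.here p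
  walk-reverse E-sym (WalkIn.step p e w) = walk-reverse E-sym w ++ʷ WalkIn.step (walk-start w) (E-sym e) (WalkIn.here p)
    where
    walk-start : ∀ {P x y} → WalkIn E P x y → P x
    walk-start (WalkIn.here p)     = p
    walk-start (WalkIn.step p _ _) = p

  -- `go` discards everything up to the last visit to x. Its first alternative, a walk that never
  -- visits x, is impossible for a walk starting at x.
  last-exit : ∀ {P z} x → z ≢ x → WalkIn E P x z → ∃ λ y → E x y × WalkIn E (λ w → P w × w ≢ x) y z
  last-exit {P} {z} x z≢x w with go w
    where
    go : ∀ {a} → WalkIn E P a z →
      WalkIn E (λ w → P w × w ≢ x) a z ⊎ ∃ λ y → E x y × WalkIn E (λ w → P w × w ≢ x) y z
    go (WalkIn.here p) = inj₁ (WalkIn.here (p , z≢x))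
    go (WalkIn.step {a} p e w) with go w
    ... | inj₂ r  = inj₂ r
    ... | inj₁ w′ with a Fin.≟ x
    ...   | yes refl = inj₂ (_ , e , w′)
    ...   | no  a≢x  = inj₁ (WalkIn.step (p , a≢x) e w′)
  ... | inj₂ r = r
  ... | inj₁ (WalkIn.here (_ , x≢x))     = contradiction refl x≢x
  ... | inj₁ (WalkIn.step (_ , x≢x) _ _) = contradiction refl x≢x

  -- SimplePath P z x xs: the nodes x ∷ xs form a path inside P from x to z.
  data SimplePath (P : Node → Set) (z : Node) : Node → List Node → Set where
    stop : P z → SimplePath P z z []
    step : ∀ {x y ys} → P x → E x y → x ∉ (y ∷ ys) → SimplePath P z y ys → SimplePath P z x (y ∷ ys)

  path-suffix : ∀ {P z x y ys} → SimplePath P z y ys → x ∈ (y ∷ ys) → ∃ λ xs → SimplePath P z x xs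
  path-suffix p              (here refl) = _ , p
  path-suffix (step _ _ _ p) (there i)   = path-suffix p i

  -- Loop erasure: if the new first node already lies on the simplified rest, the path restarts from
  -- that occurrence.
  simplify : ∀ {P x z} → WalkIn E P x z → ∃ λ xs → SimplePath P z x xs
  simplify (WalkIn.here p) = [] , stop p
  simplify (WalkIn.step {x} {y} p e w) with simplify w
  ... | ys , q with x ∈? (y ∷ ys)
    where open DecMembership (Fin._≟_ {suc m})
  ...   | yes x∈ = path-suffix q x∈
  ...   | no  x∉ = y ∷ ys , step p e x∉ q

  path-unique : ∀ {P z x xs} → SimplePath P z x xs → Unique (x ∷ xs)
  path-unique (stop _)        = [] ∷ []
  path-unique (step _ _ x∉ p) = ¬Any⇒All¬ _ x∉ ∷ path-unique p

  path-all : ∀ {P z x xs} → SimplePath P z x xs → All P (x ∷ xs)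
  path-all (stop p)       = p ∷ []
  path-all (step p _ _ q) = p ∷ path-all q

  path-linked : ∀ {P z x xs y} → SimplePath P z x xs → E z y → Linked E (x ∷ xs ++ y ∷ [])
  path-linked (stop _)       e = e ∷ [-]
  path-linked (step _ e _ q) f = e ∷ path-linked q f

module TreeProperties (T : Tree) where
  open Tree T renaming (sym to TE-sym)

  Node : Set
  Node = Fin (suc m)

  Avoiding : Node → Node → Node → Set
  Avoiding x = WalkIn TE (_≢ x)

  -- A simple path between distinct neighbours of x that avoids x would close up to a cycle through
  -- x.
  neighbour-unique : ∀ {x y y′} → TE x y → TE x y′ → Avoiding x y y′ → y ≡ y′
  neighbour-unique {x} {y} {y′} e e′ w with y Fin.≟ y′ | simplify w
  ... | yes y≡y′ | _ = y≡y′
  ... | no  y≢y′ | [] , stop _ = contradiction refl y≢y′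
  ... | no  y≢y′ | z ∷ zs , p = contradiction
    (x , y ∷ z ∷ zs , s≤s (s≤s z≤n) , All.map (_∘ sym) (path-all p) ∷ path-unique p , e ∷ path-linked p (TE-sym e′))
    acyclic

  toward′ : ∀ x z → z ≢ x → ∃ λ y → TE x y × Avoiding x y z
  toward′ x z z≢x with last-exit x z≢x (connected x z)
  ... | y , e , w = y , e , walk-map proj₂ w

  -- The neighbour of x in the component of T - x containing z (and the junk value x if z is x).
  toward : Node → Node → Node
  toward x z with z Fin.≟ x
  ... | yes _   = x
  ... | no  z≢x = proj₁ (toward′ x z z≢x)

  toward-spec : ∀ {x z} → z ≢ x → TE x (toward x z) × Avoiding x (toward x z) z
  toward-spec {x} {z} z≢x with z Fin.≟ x
  ... | yes z≡x = contradiction z≡x z≢x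
  ... | no  z≢x = proj₂ (toward′ x z z≢x)

  toward-cong : ∀ {x z z′} → z ≢ x → Avoiding x z z′ → toward x z ≡ toward x z′
  toward-cong z≢x w =
    neighbour-unique (proj₁ (toward-spec z≢x)) (proj₁ (toward-spec (walk-end w)))
      (proj₂ (toward-spec z≢x) ++ʷ w ++ʷ walk-reverse TE-sym (proj₂ (toward-spec (walk-end w))))

  iterate : (Node → Node) → ℕ → Node → Node
  iterate f zero    x = x
  iterate f (suc n) x = f (iterate f n x)

  -- Without a turning point the iterates of f would never return to a node already left.
  turning-point : (f : Node → Node) → (∀ x → TE x (f x)) → ∃ λ x → f (f x) ≡ x
  turning-point f edge with any? (λ x → f (f x) Fin.≟ x)
  ... | yes p = p
  ... | no ¬p with pigeonhole (n<1+n (suc m)) (λ i → iterate f (toℕ i) zero)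
  ...   | i , j , i<j , eq = contradiction (sym eq) (walk-end (subst (Avoiding xᵢ (f xᵢ)) recombine (leave (toℕ j ∸ suc (toℕ i)))))
    where
    xᵢ = iterate f (toℕ i) zero
    leave : ∀ {x} n → Avoiding x (f x) (iterate f n (f x))
    leave {x} zero = WalkIn.here λ fx≡x → irrefl (subst (TE x) fx≡x (edge x))
    leave {x} (suc n) with leave {x} n
    -- A step back into x would come from a neighbour of x in the component of `f x`, hence from
    -- `f x` itself, making x a turning point.
    ... | w = w ++ʷ WalkIn.step (walk-end w) (edge _) (WalkIn.here λ back →
          contradiction (_ , trans (cong f (neighbour-unique (edge x)
            (TE-sym (subst (TE _) back (edge _))) w)) back) ¬p)
    shift : ∀ n x → iterate f n (f x) ≡ iterate f (suc n) x
    shift zero    x = refl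
    shift (suc n) x = cong f (shift n x)
    iterate-+ : ∀ a b x → iterate f a (iterate f b x) ≡ iterate f (a + b) x
    iterate-+ zero    b x = refl
    iterate-+ (suc a) b x = cong f (iterate-+ a b x)
    recombine : iterate f (toℕ j ∸ suc (toℕ i)) (f xᵢ) ≡ iterate f (toℕ j) zero
    recombine = trans (iterate-+ (toℕ j ∸ suc (toℕ i)) (suc (toℕ i)) zero)
      (cong (λ n → iterate f n zero) (m∸n+n≡m i<j))

-- Branches of a tree decomposition

module Branches {G : Graph} (D : TreeDecomposition G) where
  open Graph G
  open TreeDecomposition D renaming (sym to TE-sym)
  open TreeProperties tree public

  node : V → Node
  node v = proj₁ (nonempty v)

  -- Meaningful for v outside the bag of x: the nodes holding v then lie in one component of T - x,
  -- so the choice made by `node` is immaterial.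
  branch : Node → V → Node
  branch x v = toward x (node v)

  Share : V → V → Set
  Share u v = ∃ λ z → u ∈ bag z × v ∈ bag z

  outside⇒node≢ : ∀ {x u z} → u ∉ bag x → u ∈ bag z → z ≢ x
  outside⇒node≢ u∉ u∈ refl = u∉ u∈

  walk-outside : ∀ {x u y z} → u ∉ bag x → u ∈ bag y → u ∈ bag z → Avoiding x y z
  walk-outside u∉ u∈y u∈z = walk-map (outside⇒node≢ u∉) (subtree _ _ _ u∈y u∈z)

  branch-edge : ∀ {x u} → u ∉ bag x → TE x (branch x u)
  branch-edge u∉ = proj₁ (toward-spec (outside⇒node≢ u∉ (proj₂ (nonempty _))))

  -- The subtrees of u and v both avoid x and join at the shared node.
  share⇒same-branch : ∀ {x u v} → Share u v → u ∉ bag x → v ∉ bag x → branch x u ≡ branch x v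
  share⇒same-branch (z , u∈ , v∈) u∉ v∉ = toward-cong (outside⇒node≢ u∉ (proj₂ (nonempty _)))
    (walk-outside u∉ (proj₂ (nonempty _)) u∈ ++ʷ walk-outside v∉ v∈ (proj₂ (nonempty _)))

  -- A shared node z could be reached from y avoiding x and from x avoiding y. The last exit of the
  -- second walk from x is a neighbour other than y in the component of T - x that contains y.
  opposite-branches : ∀ {x y u v} → TE x y → u ∉ bag x → branch x u ≡ y →
    v ∉ bag y → branch y v ≡ x → ¬ Share u v
  opposite-branches {x} {y} {u} {v} e u∉x refl v∉y br (z , u∈z , v∈z)
    with last-exit x (outside⇒node≢ u∉x u∈z) x⇝z
    where
    x⇝z : Avoiding y x z
    x⇝z = subst (λ a → Avoiding y a z) br
      (proj₂ (toward-spec (outside⇒node≢ v∉y (proj₂ (nonempty v)))) ++ʷ walk-outside v∉y (proj₂ (nonempty v)) v∈z)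
  ... | x′ , e′ , w = contradiction (sym (neighbour-unique e e′ (y⇝z ++ʷ walk-reverse TE-sym (walk-map proj₂ w))))
                                    (x′≢y w)
    where
    y⇝z : Avoiding x y z
    y⇝z = proj₂ (toward-spec (outside⇒node≢ u∉x (proj₂ (nonempty u)))) ++ʷ walk-outside u∉x (proj₂ (nonempty u)) u∈z
    x′≢y : WalkIn TE (λ a → a ≢ y × a ≢ x) x′ z → x′ ≢ y
    x′≢y (WalkIn.here (p , _))     = p
    x′≢y (WalkIn.step (p , _) _ _) = p

-- The lower bound

does⇒ : ∀ {P : Set} (P? : Dec P) → does P? ≡ true → P
does⇒ (yes p) _ = p

not-does⇒ : ∀ {P : Set} (P? : Dec P) → not (does P?) ≡ true → ¬ P
not-does⇒ (no ¬p) _ = ¬p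

∧⇒ : ∀ a {b} → a ∧ b ≡ true → a ≡ true × b ≡ true
∧⇒ true p = refl , p

#-∪ : ∀ m k (f g h : Family m) → (∀ s → ∣ s ∣ ≡ k → h s ≡ true → f s ≡ true ⊎ g s ≡ true) →
  # m k h ≤ # m k f + # m k g
#-∪ m k f g h H = ≤-trans (∑-mono m k (λ s e → pointwise (f s) (g s) (h s) (H s e)))
  (≤-reflexive (∑-+ m k (𝟙 ∘ f) (𝟙 ∘ g)))
  where
  pointwise : ∀ a b c → (c ≡ true → a ≡ true ⊎ b ≡ true) → 𝟙 c ≤ 𝟙 a + 𝟙 b
  pointwise a b false H = z≤n
  pointwise a b true  H with H refl
  ... | inj₁ refl = s≤s z≤n
  ... | inj₂ refl = m≤n+m 1 (𝟙 a)

#-subsingleton : ∀ m k (f : Family m) t → (∀ s → f s ≡ true → s ≡ t) → # m k f ≤ 1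
#-subsingleton zero    zero    f t h = 𝟙≤1 (f [])
#-subsingleton zero    (suc k) f t h = z≤n
#-subsingleton (suc m) zero    f (b ∷ t) h = #-subsingleton m zero _ t (λ s p → ∷-injectiveʳ (h _ p))
#-subsingleton (suc m) (suc k) f (true ∷ t) h = +-mono-≤
  (#-subsingleton m k _ t (λ s p → ∷-injectiveʳ (h _ p)))
  (≤-reflexive (#-empty m (suc k) _ λ s _ p → contradiction (∷-injectiveˡ (h _ p)) λ ()))
#-subsingleton (suc m) (suc k) f (false ∷ t) h = +-mono-≤ {y = 0}
  (≤-reflexive (#-empty m k _ λ s _ p → contradiction (∷-injectiveˡ (h _ p)) λ ()))
  (#-subsingleton m (suc k) _ t (λ s p → ∷-injectiveʳ (h _ p)))

-- Counting vertices of the Kneser graph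

_≟ˢ_ : ∀ {m} → DecidableEquality (Subset m)
_≟ˢ_ = ≡-dec Bool._≟_

Vertex : ℕ → ℕ → Set
Vertex n k = Σ (Subset n) λ s → ∣ s ∣ ≡ k

vertex-≡ : ∀ {n k} {u v : Vertex n k} → proj₁ u ≡ proj₁ v → u ≡ v
vertex-≡ {u = s , p} {.s , q} refl = cong (s ,_) (≡-irrelevant p q)

_≟ᵛ_ : ∀ {n k} → DecidableEquality (Vertex n k)
u ≟ᵛ v with proj₁ u ≟ˢ proj₁ v
... | yes p = yes (vertex-≡ p)
... | no ¬p = no (¬p ∘ cong proj₁)

family : ∀ {n k} → (Vertex n k → Bool) → Family n
family {k = k} p s with ∣ s ∣ ≟ k
... | yes e = p (s , e)
... | no  _ = false

family⇒ : ∀ {n k} (p : Vertex n k → Bool) s e → family p s ≡ true → p (s , e) ≡ true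
family⇒ {k = k} p s e q with ∣ s ∣ ≟ k
... | yes e′ = subst (λ e → p (s , e) ≡ true) (≡-irrelevant e′ e) q

family⇐ : ∀ {n k} (p : Vertex n k → Bool) s e → p (s , e) ≡ true → family p s ≡ true
family⇐ {k = k} p s e q with ∣ s ∣ ≟ k
... | yes e′ = subst (λ e → p (s , e) ≡ true) (≡-irrelevant e e′) q
... | no ¬e  = contradiction e ¬e

count : ∀ {n k} → (Vertex n k → Bool) → ℕ
count {n} {k} p = # n k (family p)

count-mono : ∀ {n k} {p q : Vertex n k → Bool} → (∀ v → p v ≡ true → q v ≡ true) → count p ≤ count q
count-mono {n} {k} {p} {q} h = ∑-mono n k λ s e → pointwise (family p s) (family q s)
    (λ r → family⇐ q s e (h _ (family⇒ p s e r)))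
  where
  pointwise : ∀ a b → (a ≡ true → b ≡ true) → 𝟙 a ≤ 𝟙 b
  pointwise false b h = z≤n
  pointwise true  b h rewrite h refl = ≤-refl

count-∪ : ∀ {n k} {p q r : Vertex n k → Bool} → (∀ v → r v ≡ true → p v ≡ true ⊎ q v ≡ true) →
  count r ≤ count p + count q
count-∪ {n} {k} {p} {q} {r} h = #-∪ n k (family p) (family q) (family r) λ s e t →
  Sum.map (family⇐ p s e) (family⇐ q s e) (h _ (family⇒ r s e t))

count-true : ∀ {n k} → n C k ≤ count {n} {k} (λ _ → true)
count-true {n} {k} = ≤-trans (≤-reflexive (sym (∑-1 n k)))
  (∑-mono n k λ s e → ≤-reflexive (cong 𝟙 (sym (family⇐ (λ _ → true) s e refl))))

module _ {n k : ℕ} where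
  open DecMembership (_≟ᵛ_ {n} {k}) public using (_∈?_)

count-∈ : ∀ {n k} (vs : List (Vertex n k)) → count (λ v → does (v ∈? vs)) ≤ length vs
count-∈ {n} {k} [] = ≤-reflexive (#-empty n k _ λ s e p → contradiction (family⇒ _ s e p) λ ())
count-∈ {n} {k} (u ∷ vs) = ≤-trans
  (count-∪ {p = λ v → does (v ≟ᵛ u)} {q = λ v → does (v ∈? vs)} {r = λ v → does (v ∈? (u ∷ vs))} split)
  (+-mono-≤ (#-subsingleton n k _ (proj₁ u) unique) (count-∈ vs))
  where
  split : ∀ v → does (v ∈? (u ∷ vs)) ≡ true → does (v ≟ᵛ u) ≡ true ⊎ does (v ∈? vs) ≡ true
  split v p with does⇒ (v ∈? (u ∷ vs)) p
  ... | here q  = inj₁ (dec-true (v ≟ᵛ u) q)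
  ... | there q = inj₂ (dec-true (v ∈? vs) q)
  unique : ∀ s → family (λ v → does (v ≟ᵛ u)) s ≡ true → s ≡ proj₁ u
  unique s p with ∣ s ∣ ≟ k
  ... | yes e = cong proj₁ (does⇒ ((s , e) ≟ᵛ u) p)

-- A group holding at most three quarters leaves at least a quarter to the rest.
complement-large : ∀ {o a b} → o ≤ a + b → 4 * a ≤ 3 * o → o ≤ 4 * b
complement-large {o} {a} {b} o≤a+b 4a≤3o = +-cancelˡ-≤ (3 * o) _ _ (begin
  3 * o + o     ≡⟨ four o ⟩
  4 * o         ≤⟨ *-monoʳ-≤ 4 o≤a+b ⟩
  4 * (a + b)   ≡⟨ *-distribˡ-+ 4 a b ⟩
  4 * a + 4 * b ≤⟨ +-monoˡ-≤ (4 * b) 4a≤3o ⟩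
  3 * o + 4 * b ∎)
  where
  open ≤-Reasoning
  four : ∀ o → 3 * o + o ≡ 4 * o
  four = solve-∀

-- An increment c that lifts a total from below one quarter to above three quarters exceeds one
-- half.
increment-large : ∀ {o a b c} → b ≤ a + c → 4 * a < o → 3 * o < 4 * b → o ≤ 4 * c
increment-large {o} {a} {b} {c} b≤a+c 4a<o 3o<4b = +-cancelˡ-≤ o _ _ (begin
  o + o           ≤⟨ m≤m+n _ o ⟩
  o + o + o       ≡⟨ three o ⟩
  3 * o           ≤⟨ <⇒≤ 3o<4b ⟩
  4 * b           ≤⟨ *-monoʳ-≤ 4 b≤a+c ⟩
  4 * (a + c)     ≡⟨ *-distribˡ-+ 4 a c ⟩
  4 * a + 4 * c   ≤⟨ +-monoˡ-≤ (4 * c) (<⇒≤ 4a<o) ⟩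
  o + 4 * c       ∎)
  where
  open ≤-Reasoning
  three : ∀ o → o + o + o ≡ 3 * o
  three = solve-∀

nonadjacent⇒Meet : ∀ {m} (s t : Subset m) → ¬ Empty (s ∩ t) → Meet s t
nonadjacent⇒Meet s t h with any? (λ i → (lookup s i Bool.≟ true) ×-dec (lookup t i Bool.≟ true))
... | yes p = p
... | no ¬p = contradiction (λ { (i , i∈) → let i∈s , i∈t = x∈p∩q⁻ s t i∈ in
    ¬p (i , []=⇒lookup i∈s , []=⇒lookup i∈t) }) h

module LowerBound (m j : ℕ) (h : 4 * ((2 + j) * (1 + j)) ≤ 1 + m)
  (D : TreeDecomposition (Kneser (2 + m) (2 + j)))
  (small : ∀ x → length (TreeDecomposition.bag D x) < suc m C (2 + j)) where

  open TreeDecomposition D using (bag; nonempty; edges; TE) renaming (m to t)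
  open Branches D

  V = Vertex (2 + m) (2 + j)
  N = suc m C suc j

  -- Disjoint sets are adjacent and so share a bag, and every vertex shares a bag with itself. Hence
  -- classes with no shared node are both cross-intersecting and disjoint.
  no-balanced-ordered-pair : (p q : V → Bool) →
    (∀ u v → p u ≡ true → q v ≡ true → ¬ Share u v) →
    N < count p + count q → N < 4 * count q → count q ≤ count p → ⊥
  no-balanced-ordered-pair p q apart = no-balanced-cross m j (family p) (family q) h cross disjoint
    where
    cross : Cross (2 + j) (2 + j) (family p) (family q)
    cross s t ∣s∣ ∣t∣ s∈ t∈ = nonadjacent⇒Meet s t λ empty →
      apart (s , ∣s∣) (t , ∣t∣) (family⇒ p s ∣s∣ s∈) (family⇒ q t ∣t∣ t∈) (edges _ _ empty)
    disjoint : Disjoint (2 + j) (family p) (family q)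
    disjoint s ∣s∣ s∈p s∈q = apart _ _ (family⇒ p s ∣s∣ s∈p) (family⇒ q s ∣s∣ s∈q)
      (node (s , ∣s∣) , proj₂ (nonempty _) , proj₂ (nonempty _))

  no-balanced-pair : (p q : V → Bool) →
    (∀ u v → p u ≡ true → q v ≡ true → ¬ Share u v) →
    N < count p + count q → N < 4 * count p → N < 4 * count q → ⊥
  no-balanced-pair p q apart N<p+q N<4p N<4q with ≤-total (count q) (count p)
  ... | inj₁ q≤p = no-balanced-ordered-pair p q apart N<p+q N<4q q≤p
  ... | inj₂ p≤q = no-balanced-ordered-pair q p
    (λ u v qu pv (z , u∈ , v∈) → apart v u pv qu (z , v∈ , u∈))
    (subst (N <_) (+-comm (count p) (count q)) N<p+q) N<4p p≤q

  out : Node → V → Bool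
  out x v = not (does (v ∈? bag x))

  -- By Pascal's rule N is exactly what remains of all vertices after removing C(n-1,k) of them, and
  -- a bag has fewer.
  N<out : ∀ x → N < count (out x)
  N<out x = +-cancelʳ-< (length (bag x)) N (count (out x)) (begin-strict
    N + length (bag x)                              <⟨ +-monoʳ-< N (small x) ⟩
    N + suc m C (2 + j)                             ≡⟨ nCk+nC[k+1]≡[n+1]C[k+1] (suc m) (suc j) ⟩
    (2 + m) C (2 + j)                               ≤⟨ count-true {2 + m} {2 + j} ⟩
    count {2 + m} {2 + j} (λ _ → true)              ≤⟨ count-∪ {p = out x} cover ⟩
    count (out x) + count (λ v → does (v ∈? bag x)) ≤⟨ +-monoʳ-≤ (count (out x)) (count-∈ (bag x)) ⟩
    count (out x) + length (bag x)                  ∎)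
    where
    open ≤-Reasoning
    cover : ∀ v → true ≡ true → out x v ≡ true ⊎ does (v ∈? bag x) ≡ true
    cover v _ with does (v ∈? bag x)
    ... | true  = inj₂ refl
    ... | false = inj₁ refl

  side : Node → (Node → Bool) → V → Bool
  side x S v = out x v ∧ S (branch x v)

  side⇒ : ∀ {x} {S : Node → Bool} {v} → side x S v ≡ true → v ∉ bag x × S (branch x v) ≡ true
  side⇒ {x} {S} {v} p with ∧⇒ (out x v) p
  ... | a , b = not-does⇒ (v ∈? bag x) a , b

  side-∪ : ∀ x {S S₁ S₂ : Node → Bool} → (∀ y → S y ≡ true → S₁ y ≡ true ⊎ S₂ y ≡ true) →
    count (side x S) ≤ count (side x S₁) + count (side x S₂)
  side-∪ x {S} {S₁} {S₂} H = count-∪ {p = side x S₁} {side x S₂} {side x S} split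
    where
    split : ∀ v → side x S v ≡ true → side x S₁ v ≡ true ⊎ side x S₂ v ≡ true
    split v with out x v
    ... | true  = H (branch x v)
    ... | false = λ ()

  out≤side : ∀ x (S : Node → Bool) → count (out x) ≤ count (side x S) + count (side x (not ∘ S))
  out≤side x S = count-∪ {p = side x S} {side x (not ∘ S)} {out x} split
    where
    split : ∀ v → out x v ≡ true → side x S v ≡ true ⊎ side x (not ∘ S) v ≡ true
    split v with out x v | S (branch x v)
    ... | true  | true  = λ _ → inj₁ refl
    ... | true  | false = λ _ → inj₂ refl
    ... | false | _     = λ ()

  -- Vertices in different branches share no node, and the two groups of branches cover all vertices
  -- outside the bag.
  no-balanced-node : ∀ x (S : Node → Bool) → count (out x) ≤ 4 * count (side x S) →
    count (out x) ≤ 4 * count (side x (not ∘ S)) → ⊥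
  no-balanced-node x S p q = no-balanced-pair (side x S) (side x (not ∘ S)) apart
    (<-≤-trans (N<out x) (out≤side x S)) (<-≤-trans (N<out x) p) (<-≤-trans (N<out x) q)
    where
    apart : ∀ u v → side x S u ≡ true → side x (not ∘ S) v ≡ true → ¬ Share u v
    apart u v a b shared with side⇒ {S = S} {v = u} a | side⇒ {S = not ∘ S} {v = v} b
    ... | u∉ , Su | v∉ , ¬Sv with share⇒same-branch shared u∉ v∉
    ...   | eq with S (branch x v) | trans (cong S (sym eq)) Su
    ...     | true | _ = contradiction ¬Sv λ ()

  at : Node → Node → V → Bool
  at x y = side x (λ z → does (z Fin.≟ y))

  Heavy : Node → Node → Set
  Heavy x y = 3 * count (out x) < 4 * count (at x y)

  -- The two classes lie across the edge from each other. Each exceeds 3N/4, so together they exceed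
  -- N.
  no-edge-heavy-both-ways : ∀ {x y} → TE x y → Heavy x y → Heavy y x → ⊥
  no-edge-heavy-both-ways {x} {y} e hx hy = no-balanced-pair (at x y) (at y x) apart
    (*-cancelˡ-< 4 N _ (begin-strict
      4 * N                                 ≤⟨ *-monoˡ-≤ N {4} {6} (s≤s (s≤s (s≤s (s≤s z≤n)))) ⟩
      6 * N                                 ≡⟨ halves N ⟩
      3 * N + 3 * N                         <⟨ +-mono-< (above x (at x y) hx) (above y (at y x) hy) ⟩
      4 * count (at x y) + 4 * count (at y x) ≡⟨ sym (*-distribˡ-+ 4 (count (at x y)) _) ⟩
      4 * (count (at x y) + count (at y x)) ∎))
    (≤-<-trans (m≤n*m N 3) (above x (at x y) hx))
    (≤-<-trans (m≤n*m N 3) (above y (at y x) hy))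
    where
    open ≤-Reasoning
    halves : ∀ n → 6 * n ≡ 3 * n + 3 * n
    halves = solve-∀
    above : ∀ x (p : V → Bool) → 3 * count (out x) < 4 * count p → 3 * N < 4 * count p
    above x p = ≤-<-trans (*-monoʳ-≤ 3 (<⇒≤ (N<out x)))
    apart : ∀ u v → at x y u ≡ true → at y x v ≡ true → ¬ Share u v
    apart u v a b with side⇒ {S = λ z → does (z Fin.≟ y)} {v = u} a | side⇒ {S = λ z → does (z Fin.≟ x)} {v = v} b
    ... | u∉ , bu | v∉ , bv = opposite-branches e u∉ (does⇒ (_ Fin.≟ y) bu) v∉ (does⇒ (_ Fin.≟ x) bv)

  heavy⇒edge : ∀ {x y} → Heavy x y → TE x y
  heavy⇒edge {x} {y} p with #-witness (2 + m) (2 + j) (family (at x y)) (<4*⇒0< p)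
  ... | s , e , s∈ with side⇒ {S = λ z → does (z Fin.≟ y)} {v = s , e} (family⇒ (at x y) s e s∈)
  ...   | s∉ , b = subst (TE x) (does⇒ (_ Fin.≟ y) b) (branch-edge s∉)

  -- Ordering the branches by node index lets them be added one at a time.
  below : Node → ℕ → V → Bool
  below x i = side x (λ y → does (toℕ y <? i))

  crossing : ∀ x i → count (out x) ≤ 4 * count (below x i) →
    ∃ λ i′ → suc i′ ≤ i × 4 * count (below x i′) < count (out x) × count (out x) ≤ 4 * count (below x (suc i′))
  crossing x zero p = contradiction
    (<-≤-trans (N<out x) (≤-trans p (≤-reflexive (cong (4 *_) (#-empty _ _ (family (below x 0)) none))))) λ ()
    where
    none : ∀ s → ∣ s ∣ ≡ 2 + j → ¬ family (below x 0) s ≡ true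
    none s e s∈ with side⇒ {S = λ y → does (toℕ y <? 0)} {v = s , e} (family⇒ (below x 0) s e s∈)
    ... | _ , ()
  crossing x (suc i) p with count (out x) ≤? 4 * count (below x i)
  ... | no  q = i , ≤-refl , ≰⇒> q , p
  ... | yes q with crossing x i q
  ...   | i′ , i′<i , r = i′ , m≤n⇒m≤1+n i′<i , r

  -- Add branches until they first hold a quarter of the outside vertices. If they hold at most
  -- three quarters, this group and the rest are balanced. Otherwise the last branch alone holds a
  -- quarter and, not being heavy, is balanced against all the others.
  no-light-node : ∀ x → ¬ (∀ y → ¬ Heavy x y)
  no-light-node x light with crossing x (suc t) everything
    where
    everything : count (out x) ≤ 4 * count (below x (suc t))
    everything = ≤-trans (count-mono {p = out x} {below x (suc t)} λ v p →
      trans (cong (_∧ _) p) (dec-true (_ <? suc t) (toℕ<n (branch x v)))) (m≤n*m _ 4)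
  ... | i , i<t , below-i , above-i with 4 * count (below x (suc i)) ≤? 3 * count (out x)
  ...   | yes p = no-balanced-node x (λ y → does (toℕ y <? suc i)) above-i
    (complement-large {count (out x)} {count (below x (suc i))} (out≤side x (λ y → does (toℕ y <? suc i))) p)
  ...   | no ¬p = no-balanced-node x S
    (increment-large {count (out x)} {count (below x i)} {count (below x (suc i))} (side-∪ x new) below-i (≰⇒> ¬p))
    (complement-large {count (out x)} {count (at x y)} (out≤side x S) (≮⇒≥ (light y)))
    where
    y : Node
    y = fromℕ< i<t
    S : Node → Bool
    S z = does (z Fin.≟ y)
    new : ∀ z → does (toℕ z <? suc i) ≡ true → does (toℕ z <? i) ≡ true ⊎ S z ≡ true
    new z z<1+i with m≤n⇒m<n∨m≡n (≤-pred (does⇒ (toℕ z <? suc i) z<1+i))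
    ... | inj₁ z<i = inj₁ (dec-true (toℕ z <? i) z<i)
    ... | inj₂ z≡i = inj₂ (dec-true (z Fin.≟ y) (toℕ-injective (trans z≡i (sym (toℕ-fromℕ< i<t)))))

  impossible : ⊥
  impossible with all? (λ x → any? (λ y → 3 * count (out x) <? 4 * count (at x y)))
  ... | no ¬all with ¬∀⟶∃¬ _ _ (λ x → any? (λ y → 3 * count (out x) <? 4 * count (at x y))) ¬all
  ...   | x , ¬any = no-light-node x (λ y p → ¬any (y , p))
  impossible | yes heavy with turning-point (proj₁ ∘ heavy) (λ x → heavy⇒edge (proj₂ (heavy x)))
  ... | x , back = no-edge-heavy-both-ways (heavy⇒edge (proj₂ (heavy x))) (proj₂ (heavy x))
    (subst (Heavy (proj₁ (heavy x))) back (proj₂ (heavy (proj₁ (heavy x)))))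

-- The upper bound

adjoin : ∀ {m k} → Vertex m k → Vertex (suc m) (suc k)
adjoin (s , e) = true ∷ s , cong suc e

skip : ∀ {m k} → Vertex m k → Vertex (suc m) k
skip (s , e) = false ∷ s , e

adjoin-injective : ∀ {m k} {u v : Vertex m k} → adjoin u ≡ adjoin v → u ≡ v
adjoin-injective eq = vertex-≡ (∷-injectiveʳ (cong proj₁ eq))

skip-injective : ∀ {m k} {u v : Vertex m k} → skip u ≡ skip v → u ≡ v
skip-injective eq = vertex-≡ (∷-injectiveʳ (cong proj₁ eq))

vertices : ∀ m k → List (Vertex m k)
vertices zero    zero    = ([] , refl) ∷ []
vertices zero    (suc k) = []
vertices (suc m) zero    = map skip (vertices m zero)
vertices (suc m) (suc k) = map adjoin (vertices m k) ++ map skip (vertices m (suc k))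

∈-vertices : ∀ {m k} (v : Vertex m k) → v ∈ vertices m k
∈-vertices ([] , refl)                   = here refl
∈-vertices {k = zero}  (false ∷ s , e)    = ∈-map⁺ skip (∈-vertices (s , e))
∈-vertices {k = suc k} (false ∷ s , e)    = ∈-++⁺ʳ _ (∈-map⁺ skip (∈-vertices (s , e)))
∈-vertices             (true ∷ s , refl) = ∈-++⁺ˡ (∈-map⁺ adjoin (∈-vertices (s , refl)))

adjoin∉map-skip : ∀ {m k} {v : Vertex m k} {ws} → adjoin v ∉ map skip ws
adjoin∉map-skip p with ∈-map⁻ skip p
... | _ , _ , ()

vertices-unique : ∀ m k → Unique (vertices m k)
vertices-unique zero    zero    = [] ∷ []
vertices-unique zero    (suc k) = []
vertices-unique (suc m) zero    = Unique.map⁺ skip-injective (vertices-unique m zero)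
vertices-unique (suc m) (suc k) = Unique.++⁺ (Unique.map⁺ adjoin-injective (vertices-unique m k))
  (Unique.map⁺ skip-injective (vertices-unique m (suc k)))
  λ (p , q) → disjoint p q
  where
  disjoint : ∀ {v} → v ∈ map adjoin (vertices m k) → v ∉ map skip (vertices m (suc k))
  disjoint p q with ∈-map⁻ adjoin p
  ... | _ , _ , refl = adjoin∉map-skip q

length-vertices : ∀ m k → length (vertices m k) ≡ m C k
length-vertices zero    zero    = refl
length-vertices zero    (suc k) = refl
length-vertices (suc m) zero    = trans (List.length-map skip (vertices m zero)) (length-vertices m zero)
length-vertices (suc m) (suc k) = begin
  length (map adjoin (vertices m k) ++ map skip (vertices m (suc k)))
    ≡⟨ List.length-++ (map adjoin (vertices m k)) ⟩
  length (map adjoin (vertices m k)) + length (map skip (vertices m (suc k)))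
    ≡⟨ cong₂ _+_ (trans (List.length-map adjoin (vertices m k)) (length-vertices m k))
                 (trans (List.length-map skip (vertices m (suc k))) (length-vertices m (suc k))) ⟩
  (m C k) + (m C suc k)
    ≡⟨ nCk+nC[k+1]≡[n+1]C[k+1] m k ⟩
  suc m C suc k ∎
  where open ≡-Reasoning

lookup-injective : ∀ {A : Set} {xs : List A} → Unique xs → ∀ i j → List.lookup xs i ≡ List.lookup xs j → i ≡ j
lookup-injective (_ ∷ _)   zero    zero    _  = refl
lookup-injective (x∉ ∷ _)  zero    (suc j) eq = contradiction eq (All.lookup x∉ (∈-lookup j))
lookup-injective (x∉ ∷ _)  (suc i) zero    eq = contradiction (sym eq) (All.lookup x∉ (∈-lookup i))
lookup-injective (_ ∷ u)   (suc i) (suc j) eq = cong suc (lookup-injective u i j eq)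

maximum-≤ : ∀ {A : Set} (h : A → ℕ) xs {b} → (∀ x → h x ≤ b) → foldr _⊔_ 0 (map h xs) ≤ b
maximum-≤ h []       p = z≤n
maximum-≤ h (x ∷ xs) p = ⊔-lub (p x) (maximum-≤ h xs p)

≤-maximum : ∀ {A : Set} (h : A → ℕ) {x xs} → x ∈ xs → h x ≤ foldr _⊔_ 0 (map h xs)
≤-maximum h (here refl)        = m≤m⊔n _ _
≤-maximum h (there {x = y} p)  = ≤-trans (≤-maximum h p) (m≤n⊔m (h y) _)

enlarge : ∀ {m} (s : Subset m) → ∣ s ∣ < m →
  ∃ λ t → ∣ t ∣ ≡ suc ∣ s ∣ × (∀ i → lookup s i ≡ true → lookup t i ≡ true)
enlarge (false ∷ s) p = true ∷ s , refl , λ { (suc i) q → q }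
enlarge (true ∷ s)  (s≤s p) with enlarge s p
... | t , e , h = true ∷ t , cong suc e , λ { zero q → q ; (suc i) q → h i q }

member : ∀ {m} (s : Subset m) → 0 < ∣ s ∣ → ∃ λ i → lookup s i ≡ true
member (true ∷ s)  p = zero , refl
member (false ∷ s) p with member s p
... | i , q = suc i , q

data StarEdge {t : ℕ} : Fin (suc t) → Fin (suc t) → Set where
  outward : ∀ i → StarEdge zero (suc i)
  inward  : ∀ i → StarEdge (suc i) zero

starTree : ℕ → Tree
starTree t = record
  { m         = t
  ; TE        = StarEdge
  ; sym       = λ { (outward i) → inward i ; (inward i) → outward i }
  ; irrefl    = λ ()
  ; connected = λ x y → to-centre x ++ʷ from-centre y
  ; acyclic   = acyclic
  }
  where
  to-centre : ∀ x → WalkIn (StarEdge {t}) (λ _ → ⊤) x zero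
  to-centre zero    = WalkIn.here tt
  to-centre (suc i) = WalkIn.step tt (inward i) (WalkIn.here tt)
  from-centre : ∀ x → WalkIn (StarEdge {t}) (λ _ → ⊤) zero x
  from-centre zero    = WalkIn.here tt
  from-centre (suc i) = WalkIn.step tt (outward i) (WalkIn.here tt)
  acyclic : ¬ HasCycle (StarEdge {t})
  -- Every second node of a walk is the centre. A cycle therefore repeats the centre or, with three
  -- nodes starting at a leaf, needs an edge between two leaves.
  acyclic (zero  , _ ∷ _ ∷ _ , _ , (_ ∷ 0≢0 ∷ _) ∷ _ , outward _ ∷ inward _ ∷ _) = 0≢0 refl
  acyclic (suc _ , _ ∷ _ ∷ [] , _ , _ , inward _ ∷ outward _ ∷ () ∷ _)
  acyclic (suc _ , _ ∷ _ ∷ _ ∷ _ , _ , _ ∷ (_ ∷ 0≢0 ∷ _) ∷ _ , inward _ ∷ outward _ ∷ inward _ ∷ _) = 0≢0 refl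
  acyclic (_ , _ ∷ [] , s≤s () , _)

module UpperBound (m k : ℕ) (0<k : 0 < k) (k<m : k < m) where

  V = Vertex (suc m) (suc k)
  t = length (vertices m k)

  centre : List V
  centre = map skip (vertices m (suc k))

  apex : Fin t → V
  apex i = adjoin (List.lookup (vertices m k) i)

  Apart : V → V → Set
  Apart u v = Empty (proj₁ u ∩ proj₁ v)

  apart? : ∀ u v → Dec (Apart u v)
  apart? u v = ¬? (nonempty? (proj₁ u ∩ proj₁ v))

  -- Two sets through the first point are never disjoint, so all neighbours of an apex lie in
  -- `centre` and the filter finds each of them.
  bag : Fin (suc t) → List V
  bag zero    = centre
  bag (suc i) = apex i ∷ filter (apart? (apex i)) centre

  leaf : Vertex m k → Fin (suc t)
  leaf v = suc (index (∈-vertices v))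

  apex-leaf : ∀ v → adjoin v ≡ apex (index (∈-vertices v))
  apex-leaf v = cong adjoin (lookup-index (∈-vertices v))

  adjoin∈leaf : ∀ v → adjoin v ∈ bag (leaf v)
  adjoin∈leaf v = here (apex-leaf v)

  skip∈centre : ∀ v → skip v ∈ centre
  skip∈centre v = ∈-map⁺ skip (∈-vertices v)

  bag-unique : ∀ x → Unique (bag x)
  bag-unique zero    = Unique.map⁺ skip-injective (vertices-unique m (suc k))
  bag-unique (suc i) = ¬Any⇒All¬ _ (λ p → adjoin∉map-skip (proj₁ (∈-filter⁻ (apart? (apex i)) {xs = centre} p)))
    ∷ Unique.filter⁺ (apart? (apex i)) (bag-unique zero)

  nonempty : ∀ v → ∃ λ x → v ∈ bag x
  nonempty (false ∷ s , e)   = zero , skip∈centre (s , e)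
  nonempty (true ∷ s , refl) = leaf (s , refl) , adjoin∈leaf (s , refl)

  subtree : ∀ v x y → v ∈ bag x → v ∈ bag y → WalkIn StarEdge (λ z → v ∈ bag z) x y
  subtree (false ∷ s , e) x y p q = to-centre x p ++ʷ from-centre y q
    where
    v = skip (s , e)
    to-centre : ∀ x → v ∈ bag x → WalkIn StarEdge (λ z → v ∈ bag z) x zero
    to-centre zero    p = WalkIn.here p
    to-centre (suc i) p = WalkIn.step p (inward i) (WalkIn.here (skip∈centre (s , e)))
    from-centre : ∀ x → v ∈ bag x → WalkIn StarEdge (λ z → v ∈ bag z) zero x
    from-centre zero    p = WalkIn.here p
    from-centre (suc i) p = WalkIn.step (skip∈centre (s , e)) (outward i) (WalkIn.here p)
  subtree (true ∷ s , refl) x y p q with at-apex x p | at-apex y q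
    where
    at-apex : ∀ x → adjoin (s , refl) ∈ bag x → ∃ λ i → x ≡ suc i × adjoin (s , refl) ≡ apex i
    at-apex zero    p         = contradiction p adjoin∉map-skip
    at-apex (suc i) (here p)  = i , refl , p
    at-apex (suc i) (there p) = contradiction (proj₁ (∈-filter⁻ (apart? (apex i)) {xs = centre} p)) adjoin∉map-skip
  ... | i , refl , a | j , refl , b
    -- The enumeration has no repetitions, so a set through the first point lies in one leaf only.
    with lookup-injective (vertices-unique m k) i j (adjoin-injective (trans (sym a) b))
  ...   | refl = WalkIn.here p

  leaf-edge : ∀ u v → Apart (adjoin u) (skip v) → skip v ∈ bag (leaf u)
  leaf-edge u v h = there (∈-filter⁺ (apart? (apex (index (∈-vertices u)))) (skip∈centre v)
    (subst (λ w → Apart w (skip v)) (apex-leaf u) h))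

  edges : ∀ u v → Apart u v → ∃ λ x → u ∈ bag x × v ∈ bag x
  edges (false ∷ s , e) (false ∷ s′ , e′) h = zero , skip∈centre (s , e) , skip∈centre (s′ , e′)
  edges (true ∷ s , refl) (false ∷ s′ , e′) h =
    leaf (s , refl) , adjoin∈leaf (s , refl) , leaf-edge (s , refl) (s′ , e′) h
  edges (false ∷ s , e) (true ∷ s′ , refl) h =
    leaf (s′ , refl) , leaf-edge (s′ , refl) (s , e) (subst Empty (∩-comm (false ∷ s) (true ∷ s′)) h) ,
    adjoin∈leaf (s′ , refl)
  edges (true ∷ s , e) (true ∷ s′ , e′) h =
    contradiction (zero , x∈p∩q⁺ (lookup⇒[]= zero (true ∷ s) refl , lookup⇒[]= zero (true ∷ s′) refl)) h

  decomposition : TreeDecomposition (Kneser (suc m) (suc k))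
  decomposition = record
    { tree       = starTree t
    ; bag        = bag
    ; bag-unique = bag-unique
    ; nonempty   = nonempty
    ; subtree    = subtree
    ; edges      = edges
    }

  length-bag≤ : ∀ x → length (bag x) ≤ length centre
  length-bag≤ zero    = ≤-refl
  length-bag≤ (suc i) with List.lookup (vertices m k) i
  -- The apex adds one vertex, so the filter must drop at least one: a set of the centre containing
  -- the nonempty s meets the apex.
  ... | s , refl with enlarge s k<m | member s 0<k
  ...   | s′ , e , s⊆s′ | j , j∈s = List.filter-notAll (apart? (adjoin (s , refl))) centre
    (lose (skip∈centre (s′ , e)) (λ h → contradiction
      (suc j , x∈p∩q⁺ (lookup⇒[]= (suc j) (true ∷ s) j∈s , lookup⇒[]= (suc j) (false ∷ s′) (s⊆s′ j j∈s))) h))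

  width-decomposition : width decomposition ≡ m C suc k ∸ 1
  width-decomposition = cong (_∸ 1) (begin
    foldr _⊔_ 0 (map (length ∘ bag) (allFin (suc t)))
      ≡⟨ ≤-antisym (maximum-≤ (length ∘ bag) (allFin (suc t)) length-bag≤)
                   (≤-maximum (length ∘ bag) (∈-allFin {suc t} zero)) ⟩
    length centre         ≡⟨ List.length-map skip (vertices m (suc k)) ⟩
    length (vertices m (suc k)) ≡⟨ length-vertices m (suc k) ⟩
    m C suc k             ∎)
    where open ≡-Reasoning

width<⇒bags-small : ∀ {G : Graph} (D : TreeDecomposition G) {c} → width D < c ∸ 1 →
  ∀ x → length (TreeDecomposition.bag D x) < c
width<⇒bags-small D {suc c} w<c x = s≤s (begin
  length (bag x)          ≤⟨ ≤-maximum (length ∘ bag) (∈-allFin x) ⟩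
  -- This form is valid for truncated subtraction, even when `largest` is 0.
  largest                 ≤⟨ m≤n+m∸n largest 1 ⟩
  suc (width D)           ≤⟨ w<c ⟩
  c                       ∎)
  where
  open ≤-Reasoning
  open TreeDecomposition D using (bag; m)
  largest = foldr _⊔_ 0 (map (length ∘ bag) (allFin (suc m)))

theorem1 : (n k : ℕ) → 3 ≤ k → 4 * k * k ∸ 4 * k + 3 ≤ n →
    Treewidth≡ (Kneser n k) ((n ∸ 1) C k ∸ 1)
theorem1 zero          k             _ h = contradiction (≤-trans (m≤n+m 3 _) h) λ ()
theorem1 (suc zero)    k             _ h = contradiction (≤-trans (m≤n+m 3 _) h) λ { (s≤s ()) }
theorem1 (suc (suc m)) (suc zero)    (s≤s ()) h
theorem1 (suc (suc m)) (suc (suc j)) _ h = (decomposition , width-decomposition) , lower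
  where
  open ≤-Reasoning
  -- Exhibits 4k as a summand of 4k², so the truncated subtraction in the hypothesis is exact and
  -- equals 4k(k-1).
  factor : ∀ k → 4 * (1 + k) * (1 + k) ≡ 4 * (1 + k) + 4 * ((1 + k) * k)
  factor = solve-∀
  large : 4 * ((2 + j) * (1 + j)) ≤ 1 + m
  large = +-cancelʳ-≤ 1 _ _ (begin
    4 * ((2 + j) * (1 + j)) + 1
      ≡⟨ cong (_+ 1) (sym (m+n∸m≡n (4 * (2 + j)) _)) ⟩
    4 * (2 + j) + 4 * ((2 + j) * (1 + j)) ∸ 4 * (2 + j) + 1
      ≡⟨ cong (λ q → q ∸ 4 * (2 + j) + 1) (sym (factor (1 + j))) ⟩
    4 * (2 + j) * (2 + j) ∸ 4 * (2 + j) + 1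
      ≤⟨ +-monoʳ-≤ (4 * (2 + j) * (2 + j) ∸ 4 * (2 + j)) (s≤s z≤n) ⟩
    4 * (2 + j) * (2 + j) ∸ 4 * (2 + j) + 3
      ≤⟨ h ⟩
    2 + m
      ≡⟨ +-comm 1 (1 + m) ⟩
    1 + m + 1 ∎)
  1+j<1+m : 1 + j < 1 + m
  1+j<1+m = begin-strict
    1 + j                   <⟨ ≤-refl ⟩
    2 + j                   ≤⟨ m≤m*n (2 + j) (1 + j) ⟩
    (2 + j) * (1 + j)       ≤⟨ m≤n*m _ 4 ⟩
    4 * ((2 + j) * (1 + j)) ≤⟨ large ⟩
    1 + m                   ∎
  open UpperBound (1 + m) (1 + j) (s≤s z≤n) 1+j<1+m
  lower : ∀ D → suc m C (2 + j) ∸ 1 ≤ width D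
  lower D = ≮⇒≥ λ w<c → LowerBound.impossible m j large D (width<⇒bags-small D w<c)
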